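{- Let $G$ be a connected graph with a bridge $e=\{v_1,v_2\}$, and let $G_1$ and $G_2$ be the connected components of $G\setminus e$, with $v_1\in V(G_1)$ and $v_2\in V(G_2)$. Then $$\kappa(G)=\kappa(G_1)+\kappa(G_2)+\frac{m_{G_2}+1}{m_G}\alpha_{G_1}(v_1)+\frac{m_{G_1}+1}{m_G}\alpha_{G_2}(v_2)+\frac{(2m_{G_1}+1)(2m_{G_2}+1)}{2m_G}.$$
   Context: All graphs are finite, simple and undirected. For a graph $H$, $m_H$ is the number of edges. $G\setminus e$ is the graph obtained from $G$ by removing the edge $e$; $e$ is a bridge of the connected graph $G$ if $G\setminus e$ is disconnected. For a connected graph $H$, consider the simple random walk on $H$ (from a vertex, move to a uniformly random neighbour), with stationary distribution $\pi_j=\deg_H(j)/(2m_H)$ and mean first passage times $m_{i,j}$ from $i$ to $j$ ($i\neq j$). Kemeny's constant is $\kappa(H)=\sum_{j\neq i}\pi_jm_{i,j}$, which does not depend on the choice of the vertex $i$. The accessibility index of a vertex $v$ in $H$ is $\alpha_H(v)=\sum_{i\neq v}\pi_im_{i,v}$. For a single-vertex graph both are $0$ (empty sums). -}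

module Defs where

open import Algebra.Bundles using (CommutativeRing)
open import Data.Bool.Base using (if_then_else_)
open import Data.Fin.Base using (Fin; zero; suc; punchIn; punchOut)
open import Data.Fin.Properties using (_≟_; punchIn-punchOut) renaming (_<?_ to _<ᶠ?_)
open import Data.Fin.Subset using (Subset; _∈_; Nonempty)
open import Data.Fin.Subset.Properties using (_∈?_)
open import Data.Integer.Base as ℤ using (+_)
import Data.Integer.Properties as ℤₚ
import Data.Integer.Solver as ℤSolver
open import Data.Nat.Base as ℕ using (ℕ; zero; suc)
import Data.Nat.Properties as ℕₚ
open import Data.Product.Base using (∃; _×_; _,_; proj₁; proj₂)
open import Data.Rational.Base
open import Data.Rational.Properties hiding (_≟_)
import Data.Rational.Properties as ℚₚ
import Data.Rational.Solver as ℚSolver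
import Data.Rational.Unnormalised.Base as ℚᵘ
import Data.Rational.Unnormalised.Properties as ℚᵘₚ
open import Data.Sum.Base using (_⊎_; inj₁; inj₂)
open import Data.Vec.Base using (Vec; []; _∷_)
open import Function.Base using (_∘_)
open import Function.Bundles using (_⇔_; Equivalence)
open import Level using (0ℓ)
open import Relation.Binary.Core using (Rel)
open import Relation.Binary.Construct.Closure.ReflexiveTransitive using (Star; _◅_) renaming (ε to stop)
open import Relation.Binary.Definitions using (Decidable; Symmetric)
open import Relation.Binary.PropositionalEquality
open import Relation.Nullary using (¬_; Dec; yes; no; does; contradiction)
open import Relation.Nullary.Decidable using (_×-dec_; _⊎-dec_; ¬?)

open import Algebra.Properties.CommutativeMonoid.Sum ℕₚ.+-0-commutativeMonoid public
  using () renaming (sum to ∑ℕ)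
open import Algebra.Properties.Semiring.Sum (CommutativeRing.semiring +-*-commutativeRing) public
  using () renaming (sum to ∑)

-- Vertices are drawn from an ambient finite set Fin n, so that a graph and
-- its subgraphs have the same type.
record Graph (n : ℕ) : Set₁ where
  field
    V      : Subset n
    _~_    : Rel (Fin n) 0ℓ
    _~?_   : Decidable _~_
    ~-sym  : Symmetric _~_
    ~-irr  : ∀ {u} → ¬ (u ~ u)
    ~-in-V : ∀ {u w} → u ~ w → u ∈ V

open Graph public using (V)

record Connected {n} (H : Graph n) : Set where
  open Graph H using (_~_)
  field
    nonempty : Nonempty (V H)
    joined   : ∀ {u w} → u ∈ V H → w ∈ V H → Star _~_ u w

_∖⟨_,_⟩ : ∀ {n} → Graph n → Fin n → Fin n → Graph n
H ∖⟨ a , b ⟩ = record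
  { V      = V H
  ; _~_    = λ u w → u ~ w × ¬ (u ≡ a × w ≡ b ⊎ u ≡ b × w ≡ a)
  ; _~?_   = λ u w → (u ~? w) ×-dec
                     ¬? (((u ≟ a) ×-dec (w ≟ b)) ⊎-dec ((u ≟ b) ×-dec (w ≟ a)))
  ; ~-sym  = λ (u~w , ne) → ~-sym u~w ,
               λ { (inj₁ (p , q)) → ne (inj₂ (q , p)) ; (inj₂ (p , q)) → ne (inj₁ (q , p)) }
  ; ~-irr  = ~-irr ∘ proj₁
  ; ~-in-V = ~-in-V ∘ proj₁
  }
  where open Graph H hiding (V)

record IsBridge {n} (H : Graph n) (a b : Fin n) : Set where
  field
    edge         : Graph._~_ H a b
    disconnected : ¬ Connected (H ∖⟨ a , b ⟩)

-- C is the subgraph of H induced on a class of the relation "joined by a path in H".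
record IsComponent {n} (C H : Graph n) : Set where
  private
    module C = Graph C
    module H = Graph H
  field
    nonempty : Nonempty C.V
    inside   : ∀ {u} → u ∈ C.V → u ∈ H.V
    class    : ∀ {u} → u ∈ C.V → ∀ w → w ∈ C.V ⇔ Star H._~_ u w
    induced  : ∀ u w → u C.~ w ⇔ (u ∈ C.V × w ∈ C.V × u H.~ w)

component-connected : ∀ {n} {C H : Graph n} → IsComponent C H → Connected C
component-connected {C = C} {H} isC = record
  { nonempty = nonempty
  ; joined   = λ {u} {w} u∈ w∈ → lift u∈ (Equivalence.to (class u∈ w) w∈)
  }
  where
  open IsComponent isC
  lift : ∀ {u w} → u ∈ V C → Star (Graph._~_ H) u w → Star (Graph._~_ C) u w
  lift u∈ stop = stop
  lift {u} u∈ (_◅_ {j = x} u~x xs) =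
    let x∈ = Equivalence.from (class u∈ x) (u~x ◅ stop) in
    Equivalence.from (induced u x) (u∈ , x∈ , u~x) ◅ lift x∈ xs

𝟙 : ∀ {a} {A : Set a} → Dec A → ℕ
𝟙 d = if does d then 1 else 0

-- Division of naturals in ℚ, with a ÷ℕ 0 = 0.
infixl 7 _÷ℕ_
_÷ℕ_ : ℕ → ℕ → ℚ
a ÷ℕ zero  = 0ℚ
a ÷ℕ suc b = + a / suc b

fromℕ : ℕ → ℚ
fromℕ a = a ÷ℕ 1

deg : ∀ {n} → Graph n → Fin n → ℕ
deg H i = ∑ℕ λ j → 𝟙 (i ~? j)
  where open Graph H

m : ∀ {n} → Graph n → ℕ
m H = ∑ℕ λ i → ∑ℕ λ j → 𝟙 ((i <ᶠ? j) ×-dec (i ~? j))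
  where open Graph H

π : ∀ {n} → Graph n → Fin n → ℚ
π H j = deg H j ÷ℕ (2 ℕ.* m H)

transition : ∀ {n} → Graph n → Fin n → Fin n → ℚ
transition H i k = 𝟙 (i ~? k) ÷ℕ deg H i
  where open Graph H

-- 𝔼 H t i F is the expectation of F(X₁,…,Xₜ) for the walk X started at X₀ = i.
𝔼 : ∀ {n} → Graph n → (t : ℕ) → Fin n → (Vec (Fin n) t → ℚ) → ℚ
𝔼 H zero    i F = F []
𝔼 H (suc t) i F = ∑ λ k → transition H i k * 𝔼 H t k (λ xs → F (k ∷ xs))

-- min(T, t), where T is the first s ≥ 1 with Xₛ = j.
passage : ∀ {n t} → Fin n → Vec (Fin n) t → ℕ
passage j []       = 0
passage j (x ∷ xs) = if does (x ≟ j) then 1 else suc (passage j xs)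

Converges : (ℕ → ℚ) → ℚ → Set
Converges s l = ∀ ε → 0ℚ < ε → ∃ λ N → ∀ t → N ℕ.≤ t → ∣ s t - l ∣ < ε

-- E(T) is the limit of the truncated expectations E(min(T, t)) as t → ∞
-- (monotone convergence; this is correct without knowing P(T < ∞) = 1).
IsMFPT : ∀ {n} → Graph n → Fin n → Fin n → ℚ → Set
IsMFPT H i j l = Converges (λ t → 𝔼 H t i (fromℕ ∘ passage j)) l

------------------------------------------------------------------------
-- Existence of the mean first passage times in ℚ.  The first-step equations
-- are solved by Gaussian elimination, and the truncated expectations are
-- shown to converge to the solution.

module Existence where

  open import Algebra.Properties.Semiring.Sum (CommutativeRing.semiring +-*-commutativeRing)
    using (sum-cong-≗; ∑-distrib-+; *-distribˡ-sum; *-distribʳ-sum)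
  open ℚSolver.+-*-Solver

  fromℚᵘ-+ : ∀ p q → fromℚᵘ (p ℚᵘ.+ q) ≡ fromℚᵘ p + fromℚᵘ q
  fromℚᵘ-+ p q = toℚᵘ-injective (ℚᵘₚ.≃-trans (toℚᵘ-fromℚᵘ (p ℚᵘ.+ q))
    (ℚᵘₚ.≃-sym (ℚᵘₚ.≃-trans (toℚᵘ-homo-+ (fromℚᵘ p) (fromℚᵘ q))
      (ℚᵘₚ.+-cong (toℚᵘ-fromℚᵘ p) (toℚᵘ-fromℚᵘ q)))))

  ÷ℕ-+ : ∀ a b d → (a ℕ.+ b) ÷ℕ d ≡ a ÷ℕ d + b ÷ℕ d
  ÷ℕ-+ a b zero    = refl
  ÷ℕ-+ a b (suc d) = trans
    (fromℚᵘ-cong {ℚᵘ.mkℚᵘ (+ (a ℕ.+ b)) d} {ℚᵘ.mkℚᵘ (+ a) d ℚᵘ.+ ℚᵘ.mkℚᵘ (+ b) d}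
      (ℚᵘ.*≡* (trans
        (cong (ℤ._* (+ suc d ℤ.* + suc d)) (ℤₚ.pos-+ a b))
        (ℤS.solve 3 (λ x y z → (x ℤS.:+ y) ℤS.:* (z ℤS.:* z)
                         ℤS.:= (x ℤS.:* z ℤS.:+ y ℤS.:* z) ℤS.:* z)
          refl (+ a) (+ b) (+ suc d)))))
    (fromℚᵘ-+ (ℚᵘ.mkℚᵘ (+ a) d) (ℚᵘ.mkℚᵘ (+ b) d))
    where module ℤS = ℤSolver.+-*-Solver

  0÷ℕ : ∀ d → 0 ÷ℕ d ≡ 0ℚ
  0÷ℕ zero    = refl
  0÷ℕ (suc d) = fromℚᵘ-cong {ℚᵘ.mkℚᵘ (+ 0) d} {ℚᵘ.mkℚᵘ (+ 0) 0} (ℚᵘ.*≡* refl)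

  n÷ℕn : ∀ d → suc d ÷ℕ suc d ≡ 1ℚ
  n÷ℕn d = fromℚᵘ-cong {ℚᵘ.mkℚᵘ (+ suc d) d} {ℚᵘ.mkℚᵘ (+ 1) 0} (ℚᵘ.*≡* (ℤₚ.*-comm (+ suc d) (+ 1)))

  ÷ℕ-nonneg : ∀ a d → 0ℚ ≤ a ÷ℕ d
  ÷ℕ-nonneg a zero    = ≤-refl
  ÷ℕ-nonneg a (suc d) = nonNegative⁻¹ _ {{normalize-nonNeg a (suc d)}}

  ÷ℕ-pos : ∀ a d → 0ℚ < suc a ÷ℕ suc d
  ÷ℕ-pos a d = positive⁻¹ _ {{normalize-pos (suc a) (suc d)}}

  ∑-÷ℕ : ∀ {n} (f : Fin n → ℕ) d → ∑ (λ k → f k ÷ℕ d) ≡ ∑ℕ f ÷ℕ d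
  ∑-÷ℕ {zero}  f d = sym (0÷ℕ d)
  ∑-÷ℕ {suc n} f d = trans (cong (_+_ (f zero ÷ℕ d)) (∑-÷ℕ (f ∘ suc) d)) (sym (÷ℕ-+ (f zero) _ d))

  ≤-∑ℕ : ∀ {n} (f : Fin n → ℕ) k → f k ℕ.≤ ∑ℕ f
  ≤-∑ℕ f zero    = ℕₚ.m≤m+n _ _
  ≤-∑ℕ f (suc k) = ℕₚ.≤-trans (≤-∑ℕ (f ∘ suc) k) (ℕₚ.m≤n+m _ (f zero))

  *-monoˡ : ∀ {p q r} → 0ℚ ≤ r → p ≤ q → r * p ≤ r * q
  *-monoˡ {r = r} 0≤r = *-monoˡ-≤-nonNeg r {{nonNegative 0≤r}}

  *-monoʳ : ∀ {p q r} → 0ℚ ≤ r → p ≤ q → p * r ≤ q * r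
  *-monoʳ {r = r} 0≤r = *-monoʳ-≤-nonNeg r {{nonNegative 0≤r}}

  *-nonneg : ∀ {p q} → 0ℚ ≤ p → 0ℚ ≤ q → 0ℚ ≤ p * q
  *-nonneg {p} {q} 0≤p 0≤q = subst (_≤ p * q) (*-zeroʳ p) (*-monoˡ 0≤p 0≤q)

  *-pos : ∀ {p q} → 0ℚ < p → 0ℚ < q → 0ℚ < p * q
  *-pos {p} {q} 0<p 0<q = subst (_< p * q) (*-zeroʳ p) (*-monoʳ-<-pos p {{positive 0<p}} 0<q)

  ∑-mono : ∀ {n} {f g : Fin n → ℚ} → (∀ k → f k ≤ g k) → ∑ f ≤ ∑ g
  ∑-mono {zero}  f≤g = ≤-refl
  ∑-mono {suc n} f≤g = +-mono-≤ (f≤g zero) (∑-mono (f≤g ∘ suc))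

  ∑-mono-< : ∀ {n} {f g : Fin n → ℚ} → (∀ k → f k ≤ g k) → ∀ k → f k < g k → ∑ f < ∑ g
  ∑-mono-< f≤g zero    lt = +-mono-<-≤ lt (∑-mono (f≤g ∘ suc))
  ∑-mono-< f≤g (suc k) lt = +-mono-≤-< (f≤g zero) (∑-mono-< (f≤g ∘ suc) k lt)

  ∑-zero : ∀ {n} (f : Fin n → ℚ) → (∀ k → f k ≡ 0ℚ) → ∑ f ≡ 0ℚ
  ∑-zero {zero}  f f≡0 = refl
  ∑-zero {suc n} f f≡0 = cong₂ _+_ (f≡0 zero) (∑-zero (f ∘ suc) (f≡0 ∘ suc))

  argmax : ∀ {n} (x : Fin n → ℚ) → Fin n → ∃ λ i → ∀ k → x k ≤ x i
  argmax {suc zero}    x _ = zero , λ { zero → ≤-refl }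
  argmax {suc (suc n)} x _ with argmax (x ∘ suc) zero
  ... | i , le with ≤-total (x zero) (x (suc i))
  ...   | inj₁ z≤ = suc i , λ { zero → z≤ ; (suc k) → le k }
  ...   | inj₂ ≤z = zero  , λ { zero → ≤-refl ; (suc k) → ≤-trans (le k) ≤z }

  archimedean : ∀ q → ∃ λ N → q < fromℕ N
  archimedean q = suc N , ≤-<-trans q≤N N<1+N
    where
    N = ℤ.∣ ↥ q ∣
    q≤N : q ≤ fromℕ N
    q≤N = toℚᵘ-cancel-≤ (ℚᵘₚ.≤-respʳ-≃ (ℚᵘₚ.≃-sym (toℚᵘ-fromℚᵘ (ℚᵘ.mkℚᵘ (+ N) 0)))
      (bound q))
      where
      i≤∣i∣ : ∀ i → i ℤ.≤ + ℤ.∣ i ∣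
      i≤∣i∣ (+ _)      = ℤₚ.≤-refl
      i≤∣i∣ ℤ.-[1+ _ ] = ℤ.-≤+
      bound : ∀ r → toℚᵘ r ℚᵘ.≤ ℚᵘ.mkℚᵘ (+ ℤ.∣ ↥ r ∣) 0
      bound (mkℚ i d _) = ℚᵘ.*≤* (subst (ℤ._≤ + ℤ.∣ i ∣ ℤ.* + suc d) (sym (ℤₚ.*-identityʳ i))
        (ℤₚ.≤-trans (i≤∣i∣ i)
          (subst (+ ℤ.∣ i ∣ ℤ.≤_) (ℤₚ.pos-* ℤ.∣ i ∣ (suc d))
            (ℤ.+≤+ (ℕₚ.m≤m*n ℤ.∣ i ∣ (suc d))))))
    N<1+N : fromℕ N < fromℕ (suc N)
    N<1+N = subst₂ _<_ (+-identityˡ _) (sym (÷ℕ-+ 1 N 1)) (+-monoˡ-< (fromℕ N) (÷ℕ-pos 0 0))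

  fromℕ-mono : ∀ {a b} → a ℕ.≤ b → fromℕ a ≤ fromℕ b
  fromℕ-mono {a} {b} a≤b = subst₂ _≤_ (+-identityʳ _)
    (trans (sym (÷ℕ-+ a (b ℕ.∸ a) 1)) (cong fromℕ (ℕₚ.m+[n∸m]≡n a≤b)))
    (+-monoʳ-≤ (fromℕ a) (÷ℕ-nonneg (b ℕ.∸ a) 1))

  -- An injective square linear system is solvable.

  Matrix : ℕ → Set
  Matrix n = Fin n → Fin n → ℚ

  infixl 7 _·_
  _·_ : ∀ {n} → Matrix n → (Fin n → ℚ) → Fin n → ℚ
  (A · x) i = ∑ λ k → A i k * x k

  module Pivot {n} (A : Matrix (suc n)) (r : Fin (suc n)) (Ar≢0 : A r zero ≢ 0ℚ) where
    instance
      _ : NonZero (A r zero)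
      _ = ≢-nonZero Ar≢0

    a⁻¹ : ℚ
    a⁻¹ = 1/ A r zero

    c : Fin n → ℚ
    c i = A (punchIn r i) zero * a⁻¹

    A′ : Matrix n
    A′ i k = A (punchIn r i) (suc k) - c i * A r (suc k)

    b′ : (Fin (suc n) → ℚ) → Fin n → ℚ
    b′ b i = b (punchIn r i) - c i * b r

    S : (Fin n → ℚ) → Fin (suc n) → ℚ
    S x′ i = ∑ λ k → A i (suc k) * x′ k

    extend : (Fin (suc n) → ℚ) → (Fin n → ℚ) → Fin (suc n) → ℚ
    extend b x′ zero    = (b r - S x′ r) * a⁻¹
    extend b x′ (suc k) = x′ k

    A′-S : ∀ x′ i → (A′ · x′) i ≡ S x′ (punchIn r i) - c i * S x′ r
    A′-S x′ i = trans
      (sum-cong-≗ λ k → solve 4 (λ u v w z → (u :- v :* w) :* z := u :* z :+ (:- v) :* (w :* z)) refl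
        (A (punchIn r i) (suc k)) (c i) (A r (suc k)) (x′ k))
      (trans (∑-distrib-+ (λ k → A (punchIn r i) (suc k) * x′ k) (λ k → (- c i) * (A r (suc k) * x′ k)))
        (cong (_+_ (S x′ (punchIn r i)))
          (trans (sym (*-distribˡ-sum (- c i) (λ k → A r (suc k) * x′ k)))
                 (sym (neg-distribˡ-* (c i) (S x′ r))))))

    row-r : ∀ b x′ → (A · extend b x′) r ≡ b r
    row-r b x′ = trans
      (solve 4 (λ a ai β σ → a :* ((β :- σ) :* ai) :+ σ := (a :* ai) :* (β :- σ) :+ σ) refl
        (A r zero) a⁻¹ (b r) (S x′ r))
      (trans (cong (λ z → z * (b r - S x′ r) + S x′ r) (*-inverseʳ (A r zero)))
        (solve 2 (λ β σ → con 1ℚ :* (β :- σ) :+ σ := β) refl (b r) (S x′ r)))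

    row-other : ∀ b x′ → (∀ i → (A′ · x′) i ≡ b′ b i) →
                ∀ i → (A · extend b x′) (punchIn r i) ≡ b (punchIn r i)
    row-other b x′ sol i = trans
      (solve 5 (λ q ai β σ τ → q :* ((β :- σ) :* ai) :+ τ := (q :* ai) :* β :+ (τ :- (q :* ai) :* σ)) refl
        (A (punchIn r i) zero) a⁻¹ (b r) (S x′ r) (S x′ (punchIn r i)))
      (trans (cong (_+_ (c i * b r)) (trans (sym (A′-S x′ i)) (sol i)))
        (solve 2 (λ u v → u :+ (v :- u) := v) refl (c i * b r) (b (punchIn r i))))

    extend-solves : ∀ b x′ → (∀ i → (A′ · x′) i ≡ b′ b i) → ∀ i → (A · extend b x′) i ≡ b i
    extend-solves b x′ sol i with r ≟ i
    ... | yes refl = row-r b x′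
    ... | no r≢i   = subst (λ z → (A · extend b x′) z ≡ b z) (punchIn-punchOut r≢i)
                       (row-other b x′ sol (punchOut r≢i))

  Injective : ∀ {n} → Matrix n → Set
  Injective A = ∀ x → (∀ i → (A · x) i ≡ 0ℚ) → ∀ i → x i ≡ 0ℚ

  pivot : ∀ {n k} (f : Fin n → Fin k → ℚ) (z : Fin k) →
          (∃ λ r → f r z ≢ 0ℚ) ⊎ (∀ r → f r z ≡ 0ℚ)
  pivot {zero}  f z = inj₂ λ ()
  pivot {suc n} f z with f zero z ℚₚ.≟ 0ℚ
  ... | no ne = inj₁ (zero , ne)
  ... | yes eq with pivot (f ∘ suc) z
  ...   | inj₁ (r , ne) = inj₁ (suc r , ne)
  ...   | inj₂ all0     = inj₂ λ { zero → eq ; (suc r) → all0 r }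

  abstract
    solvable : ∀ {n} (A : Matrix n) → Injective A → (b : Fin n → ℚ) → ∃ λ (x : Fin n → ℚ) → ∀ i → (A · x) i ≡ b i
    solvable {zero}  A inj b = (λ ()) , λ ()
    solvable {suc n} A inj b with pivot A zero
    ... | inj₂ col0 = contradiction (inj e₀ A·e₀≡0 zero) ℚₚ.1≢0
      where
      e₀ : Fin (suc n) → ℚ
      e₀ zero    = 1ℚ
      e₀ (suc _) = 0ℚ
      A·e₀≡0 : ∀ i → (A · e₀) i ≡ 0ℚ
      A·e₀≡0 i = ∑-zero (λ k → A i k * e₀ k) λ { zero → trans (cong (_* 1ℚ) (col0 i)) (*-zeroˡ 1ℚ) ; (suc k) → *-zeroʳ (A i (suc k)) }
    ... | inj₁ (r , ne) = extend b (proj₁ rec) , extend-solves b (proj₁ rec) (proj₂ rec)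
      where
      open Pivot A r ne
      inj′ : Injective A′
      inj′ x′ ker i = inj (extend (λ _ → 0ℚ) x′)
        (extend-solves (λ _ → 0ℚ) x′ λ k → trans (ker k)
          (solve 1 (λ u → con 0ℚ := con 0ℚ :- u :* con 0ℚ) refl (c k))) (suc i)
      rec : ∃ λ (x : Fin n → ℚ) → ∀ i → (A′ · x) i ≡ b′ b i
      rec = solvable A′ inj′ (b′ b)

  module Walk {n} (H : Graph n) where
    open Graph H using (_~_; _~?_; ~-sym; ~-in-V)

    p : Fin n → Fin n → ℚ
    p = transition H

    r : Fin n → ℚ
    r i = ∑ (p i)

    p≥0 : ∀ i k → 0ℚ ≤ p i k
    p≥0 i k = ÷ℕ-nonneg (𝟙 (i ~? k)) (deg H i)

    adjacent⇒deg≢0 : ∀ {i k} → i ~ k → deg H i ≢ 0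
    adjacent⇒deg≢0 {i} {k} i~k d≡0 with i ~? k | ≤-∑ℕ (λ l → 𝟙 (i ~? l)) k
    ... | yes _ | 1≤d = contradiction (subst (1 ℕ.≤_) d≡0 1≤d) λ ()
    ... | no ¬a | _   = ¬a i~k

    p≡0 : ∀ {i k} → ¬ (i ~ k) → p i k ≡ 0ℚ
    p≡0 {i} {k} ¬a with i ~? k
    ... | yes a = contradiction a ¬a
    ... | no _  = 0÷ℕ (deg H i)

    p>0 : ∀ {i k} → i ~ k → 0ℚ < p i k
    p>0 {i} {k} a with i ~? k | deg H i in eq
    ... | no ¬a | _     = contradiction a ¬a
    ... | yes _ | zero  = contradiction eq (adjacent⇒deg≢0 a)
    ... | yes _ | suc d = ÷ℕ-pos 0 d

    r≡1 : ∀ {i} → deg H i ≢ 0 → r i ≡ 1ℚ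
    r≡1 {i} ne with deg H i in eq
    ... | zero  = contradiction refl ne
    ... | suc d = trans (∑-÷ℕ (λ k → 𝟙 (i ~? k)) (suc d)) (trans (cong (_÷ℕ suc d) eq) (n÷ℕn d))

    isolated⇒p≡0 : ∀ {i} → deg H i ≡ 0 → ∀ k → p i k ≡ 0ℚ
    isolated⇒p≡0 eq k = p≡0 λ a → adjacent⇒deg≢0 a eq

    r≤1 : ∀ i → r i ≤ 1ℚ
    r≤1 i with deg H i ℕₚ.≟ 0
    ... | yes eq = subst (_≤ 1ℚ) (sym (∑-zero (p i) (isolated⇒p≡0 eq))) (÷ℕ-nonneg 1 1)
    ... | no ne  = ≤-reflexive (r≡1 ne)

    r≥0 : ∀ i → 0ℚ ≤ r i
    r≥0 i = subst (_≤ r i) (∑-zero {n} (λ _ → 0ℚ) (λ _ → refl)) (∑-mono (p≥0 i))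

    neighbour : ∀ {i} → deg H i ≢ 0 → ∃ λ k → i ~ k
    neighbour {i} ne = find (λ k → i ~? k) ne
      where
      find : ∀ {n} {P : Fin n → Set} (P? : ∀ k → Dec (P k)) → ∑ℕ (λ k → 𝟙 (P? k)) ≢ 0 → ∃ P
      find {zero}  P? ne = contradiction refl ne
      find {suc n} P? ne with P? zero
      ... | yes q = zero , q
      ... | no _  with find (P? ∘ suc) ne
      ...   | k , q = suc k , q

    𝔼-cong : ∀ t i {F F′} → (∀ xs → F xs ≡ F′ xs) → 𝔼 H t i F ≡ 𝔼 H t i F′
    𝔼-cong zero    i eq = eq []
    𝔼-cong (suc t) i eq = sum-cong-≗ λ k → cong (p i k *_) (𝔼-cong t k λ xs → eq (k ∷ xs))

    𝔼-+ : ∀ t i F F′ → 𝔼 H t i (λ xs → F xs + F′ xs) ≡ 𝔼 H t i F + 𝔼 H t i F′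
    𝔼-+ zero    i F F′ = refl
    𝔼-+ (suc t) i F F′ = trans
      (sum-cong-≗ λ k → trans (cong (p i k *_) (𝔼-+ t k (F ∘ (k ∷_)) (F′ ∘ (k ∷_))))
        (*-distribˡ-+ (p i k) _ _))
      (∑-distrib-+ (λ k → p i k * 𝔼 H t k (F ∘ (k ∷_))) (λ k → p i k * 𝔼 H t k (F′ ∘ (k ∷_))))

    p*𝔼1 : ∀ t i k → p i k * 𝔼 H t k (λ _ → 1ℚ) ≡ p i k
    p*𝔼1 t i k with i ~? k
    ... | no _  = trans (cong (_* 𝔼 H t k (λ _ → 1ℚ)) (0÷ℕ (deg H i))) (trans (*-zeroˡ (𝔼 H t k (λ _ → 1ℚ))) (sym (0÷ℕ (deg H i))))
    ... | yes a = trans (cong (1 ÷ℕ deg H i *_) (𝔼1 t (adjacent⇒deg≢0 (~-sym a)))) (*-identityʳ _)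
      where
      𝔼1 : ∀ t {k} → deg H k ≢ 0 → 𝔼 H t k (λ _ → 1ℚ) ≡ 1ℚ
      𝔼1 zero    ne = refl
      𝔼1 (suc t) {k} ne = trans (sum-cong-≗ (p*𝔼1 t k)) (r≡1 ne)

  module Passage {n} (H : Graph n) (conn : Connected H) (j : Fin n) (j∈ : j ∈ V H) where
    open Graph H using (_~_; _~?_; ~-sym; ~-in-V)
    open Walk H

    Q : Matrix n
    Q i k = if does (k ≟ j) then 0ℚ else p i k

    Q≥0 : ∀ i k → 0ℚ ≤ Q i k
    Q≥0 i k with k ≟ j
    ... | yes _ = ≤-refl
    ... | no _  = p≥0 i k

    Q≤p : ∀ i k → Q i k ≤ p i k
    Q≤p i k with k ≟ j
    ... | yes _ = p≥0 i k
    ... | no _  = ≤-refl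

    Q-mono : ∀ {x y} → (∀ k → x k ≤ y k) → ∀ i → (Q · x) i ≤ (Q · y) i
    Q-mono x≤y i = ∑-mono λ k → *-monoˡ (Q≥0 i k) (x≤y k)

    Q-isolated : ∀ {i} → deg H i ≡ 0 → ∀ x → (Q · x) i ≡ 0ℚ
    Q-isolated {i} eq x = ∑-zero (λ k → Q i k * x k) λ k →
      trans (cong (_* x k) (≤-antisym (subst (Q i k ≤_) (isolated⇒p≡0 eq k) (Q≤p i k)) (Q≥0 i k))) (*-zeroˡ (x k))

    module _ (x : Fin n → ℚ) (sub : ∀ i → x i ≤ (Q · x) i) where

      step : ∀ i → (∀ k → x k ≤ x i) → 0ℚ < x i → ∀ k → i ~ k → k ≢ j × x k ≡ x i
      step i top pos k i~k = k≢j , eq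
        where
        le : ∀ l → Q i l * x l ≤ p i l * x i
        le l with l ≟ j
        ... | yes _ = subst (_≤ p i l * x i) (sym (*-zeroˡ (x l))) (*-nonneg (p≥0 i l) (<⇒≤ pos))
        ... | no _  = *-monoˡ (p≥0 i l) (top l)
        total : ∑ (λ l → p i l * x i) ≡ x i
        total = trans (sym (*-distribʳ-sum (x i) (p i)))
          (trans (cong (_* x i) (r≡1 (adjacent⇒deg≢0 i~k))) (*-identityˡ (x i)))
        not-strict : ¬ (Q i k * x k < p i k * x i)
        not-strict lt = <-irrefl refl
          (≤-<-trans (sub i) (<-≤-trans (∑-mono-< le k lt) (≤-reflexive total)))
        k≢j : k ≢ j
        k≢j k≡j = not-strict strict
          where
          strict : Q i k * x k < p i k * x i
          strict with k ≟ j
          ... | yes _ = subst (_< p i k * x i) (sym (*-zeroˡ (x k))) (*-pos (p>0 i~k) pos)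
          ... | no ne = contradiction k≡j ne
        eq : x k ≡ x i
        eq = ≤-antisym (top k) (≮⇒≥ λ lt → not-strict (strict lt))
          where
          strict : x k < x i → Q i k * x k < p i k * x i
          strict lt with k ≟ j
          ... | yes k≡j = contradiction k≡j k≢j
          ... | no _    = *-monoʳ-<-pos (p i k) {{positive (p>0 i~k)}} lt

      no-path : ∀ {k} → Star _~_ k j → (∀ l → x l ≤ x k) → 0ℚ < x k → ¬ (k ≢ j)
      no-path stop top pos k≢j = k≢j refl
      no-path {k} (_◅_ {j = l} k~l rest) top pos _ with step k top pos l k~l
      ... | l≢j , eq = no-path rest (λ z → subst (x z ≤_) (sym eq) (top z)) (subst (0ℚ <_) (sym eq) pos) l≢j

      max≤0 : ∀ i → (∀ k → x k ≤ x i) → x i ≤ 0ℚ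
      max≤0 i top = ≮⇒≥ absurd
        where
        absurd : ¬ (0ℚ < x i)
        absurd pos with deg H i ℕₚ.≟ 0
        ... | yes eq = <-irrefl refl (<-≤-trans pos (subst (x i ≤_) (Q-isolated eq x) (sub i)))
        ... | no ne with neighbour ne
        ...   | k , i~k with step i top pos k i~k
        ...     | k≢j , eq = no-path (Connected.joined conn (~-in-V (~-sym i~k)) j∈)
                    (λ l → subst (x l ≤_) (sym eq) (top l)) (subst (0ℚ <_) (sym eq) pos) k≢j

      subharmonic≤0 : ∀ i → x i ≤ 0ℚ
      subharmonic≤0 i with argmax x i
      ... | M , top = ≤-trans (top i) (max≤0 M top)

    Q-neg : ∀ x i → (Q · (-_ ∘ x)) i ≡ - (Q · x) i
    Q-neg x i = trans
      (sum-cong-≗ λ k → trans (sym (neg-distribʳ-* (Q i k) (x k)))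
         (solve 1 (λ u → :- u := (:- con 1ℚ) :* u) refl (Q i k * x k)))
      (trans (sym (*-distribˡ-sum (- 1ℚ) (λ k → Q i k * x k)))
         (solve 1 (λ u → (:- con 1ℚ) :* u := :- u) refl ((Q · x) i)))

    superharmonic≥0 : ∀ x → (∀ i → (Q · x) i ≤ x i) → ∀ i → 0ℚ ≤ x i
    superharmonic≥0 x sup i = subst (0ℚ ≤_) (solve 1 (λ u → :- (:- u) := u) refl (x i))
      (neg-antimono-≤ (subharmonic≤0 (-_ ∘ x) (λ k → subst (- x k ≤_) (sym (Q-neg x k)) (neg-antimono-≤ (sup k))) i))

    δ : ∀ {n} → Matrix n
    δ zero    zero    = 1ℚ
    δ zero    (suc k) = 0ℚ
    δ (suc i) zero    = 0ℚ
    δ (suc i) (suc k) = δ i k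

    δ· : ∀ {n} (x : Fin n → ℚ) i → (δ · x) i ≡ x i
    δ· {suc n} x zero    = trans
      (cong₂ _+_ (*-identityˡ (x zero)) (∑-zero (λ k → 0ℚ * x (suc k)) λ k → *-zeroˡ (x (suc k))))
      (+-identityʳ (x zero))
    δ· {suc n} x (suc i) = trans
      (cong₂ _+_ (*-zeroˡ (x zero)) (δ· (x ∘ suc) i))
      (+-identityˡ (x (suc i)))

    I-Q : Matrix n
    I-Q i k = δ i k - Q i k

    I-Q· : ∀ x i → (I-Q · x) i ≡ x i - (Q · x) i
    I-Q· x i = trans
      (sum-cong-≗ λ k → trans (*-distribʳ-+ (x k) (δ i k) (- Q i k))
         (cong (_+_ (δ i k * x k)) (solve 2 (λ q y → (:- q) :* y := q :* (:- y)) refl (Q i k) (x k))))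
      (trans (∑-distrib-+ (λ k → δ i k * x k) (λ k → Q i k * (- x k)))
         (cong₂ _+_ (δ· x i) (Q-neg x i)))

    x≡x-y+y : ∀ x y → x ≡ (x - y) + y
    x≡x-y+y = solve 2 (λ u v → u := (u :- v) :+ v) refl

    I-Q-injective : Injective I-Q
    I-Q-injective x ker i = ≤-antisym
      (subharmonic≤0 x (≤-reflexive ∘ fixed) i) (superharmonic≥0 x (≤-reflexive ∘ sym ∘ fixed) i)
      where
      fixed : ∀ i → x i ≡ (Q · x) i
      fixed i = trans (x≡x-y+y (x i) ((Q · x) i))
        (trans (cong (_+ (Q · x) i) (trans (sym (I-Q· x i)) (ker i))) (+-identityˡ _))

    abstract
      h : Fin n → ℚ
      h = proj₁ (solvable I-Q I-Q-injective r)

      h-eq : ∀ i → h i ≡ r i + (Q · h) i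
      h-eq i = trans (x≡x-y+y (h i) ((Q · h) i))
        (cong (_+ (Q · h) i) (trans (sym (I-Q· h i)) (proj₂ (solvable I-Q I-Q-injective r) i)))

    h≥0 : ∀ i → 0ℚ ≤ h i
    h≥0 = superharmonic≥0 h λ i → subst₂ _≤_ (+-identityˡ _) (sym (h-eq i)) (+-monoˡ-≤ ((Q · h) i) (r≥0 i))

    u : ℕ → Fin n → ℚ
    u t i = 𝔼 H t i (fromℕ ∘ passage j)

    u-step : ∀ t i → u (suc t) i ≡ r i + (Q · u t) i
    u-step t i = trans (sum-cong-≗ term) (∑-distrib-+ (p i) (λ k → Q i k * u t k))
      where
      term : ∀ k → p i k * 𝔼 H t k (λ xs → fromℕ (passage j (k ∷ xs))) ≡ p i k + Q i k * u t k
      term k with k ≟ j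
      ... | yes _ = trans (p*𝔼1 t i k) (solve 2 (λ a b → a := a :+ con 0ℚ :* b) refl (p i k) (u t k))
      ... | no _  = trans
        (cong (p i k *_) (trans (𝔼-cong t k λ xs → ÷ℕ-+ 1 (passage j xs) 1)
           (𝔼-+ t k (λ _ → 1ℚ) (fromℕ ∘ passage j))))
        (trans (*-distribˡ-+ (p i k) _ _) (cong (_+ p i k * u t k) (p*𝔼1 t i k)))

    w : ℕ → Fin n → ℚ
    w zero    = r
    w (suc t) = Q · w t

    w≤r : ∀ t i → w t i ≤ r i
    w≤r zero    i = ≤-refl
    w≤r (suc t) i = ∑-mono λ k → ≤-trans
      (*-monoˡ (Q≥0 i k) (≤-trans (w≤r t k) (r≤1 k)))
      (subst (_≤ p i k) (sym (*-identityʳ (Q i k))) (Q≤p i k))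

    Q-linear : ∀ c x i → (Q · (λ k → c * x k)) i ≡ c * (Q · x) i
    Q-linear c x i = trans
      (sum-cong-≗ λ k → solve 3 (λ q c x → q :* (c :* x) := c :* (q :* x)) refl (Q i k) c (x k))
      (sym (*-distribˡ-sum c (λ k → Q i k * x k)))

    Q-+ : ∀ x y i → (Q · (λ k → x k + y k)) i ≡ (Q · x) i + (Q · y) i
    Q-+ x y i = trans (sum-cong-≗ λ k → *-distribˡ-+ (Q i k) (x k) (y k))
      (∑-distrib-+ (λ k → Q i k * x k) (λ k → Q i k * y k))

    u≤h : ∀ t i → u t i ≤ h i
    u≤h zero    i = h≥0 i
    u≤h (suc t) i = subst₂ _≤_ (sym (u-step t i)) (sym (h-eq i)) (+-monoʳ-≤ (r i) (Q-mono (u≤h t) i))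

    t*w≤u : ∀ t i → fromℕ t * w t i ≤ u t i
    t*w≤u zero    i = ≤-reflexive (*-zeroˡ (r i))
    t*w≤u (suc t) i = begin
      fromℕ (suc t) * w (suc t) i                  ≡⟨ cong (_* w (suc t) i) (÷ℕ-+ 1 t 1) ⟩
      (1ℚ + fromℕ t) * w (suc t) i                 ≡⟨ solve 2 (λ a b → (con 1ℚ :+ a) :* b := b :+ a :* b) refl (fromℕ t) (w (suc t) i) ⟩
      w (suc t) i + fromℕ t * w (suc t) i          ≤⟨ +-monoˡ-≤ _ (w≤r (suc t) i) ⟩
      r i + fromℕ t * w (suc t) i                  ≡⟨ cong (_+_ (r i)) (sym (Q-linear (fromℕ t) (w t) i)) ⟩
      r i + (Q · (λ k → fromℕ t * w t k)) i        ≤⟨ +-monoʳ-≤ (r i) (Q-mono (t*w≤u t) i) ⟩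
      r i + (Q · u t) i                            ≡⟨ sym (u-step t i) ⟩
      u (suc t) i                                  ∎
      where open ≤-Reasoning

    abstract
      B : ℚ
      B = h (proj₁ (argmax h j))

      h≤B : ∀ i → h i ≤ B
      h≤B = proj₂ (argmax h j)

    B≥0 : 0ℚ ≤ B
    B≥0 = ≤-trans (h≥0 j) (h≤B j)

    h≤B*r : ∀ i → h i ≤ B * r i
    h≤B*r i = by-degree (deg H i ℕₚ.≟ 0)
      where
      open ≤-Reasoning
      by-degree : Dec (deg H i ≡ 0) → h i ≤ B * r i
      by-degree (yes eq) = begin
        h i              ≡⟨ h-eq i ⟩
        r i + (Q · h) i  ≡⟨ cong₂ _+_ (∑-zero (p i) (isolated⇒p≡0 eq)) (Q-isolated eq h) ⟩
        0ℚ               ≤⟨ *-nonneg B≥0 (r≥0 i) ⟩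
        B * r i          ∎
      by-degree (no ne)  = begin
        h i              ≤⟨ h≤B i ⟩
        B                ≡⟨ sym (*-identityʳ B) ⟩
        B * 1ℚ           ≡⟨ cong (B *_) (sym (r≡1 ne)) ⟩
        B * r i          ∎

    h≤u+Bw : ∀ t i → h i ≤ u t i + B * w t i
    h≤u+Bw zero    i = subst (h i ≤_) (sym (+-identityˡ (B * r i))) (h≤B*r i)
    h≤u+Bw (suc t) i = begin
      h i                                          ≡⟨ h-eq i ⟩
      r i + (Q · h) i                              ≤⟨ +-monoʳ-≤ (r i) (Q-mono (h≤u+Bw t) i) ⟩
      r i + (Q · (λ k → u t k + B * w t k)) i      ≡⟨ cong (_+_ (r i)) (trans (Q-+ (u t) (λ k → B * w t k) i)
                                                        (cong (_+_ ((Q · u t) i)) (Q-linear B (w t) i))) ⟩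
      r i + ((Q · u t) i + B * w (suc t) i)        ≡⟨ sym (+-assoc (r i) ((Q · u t) i) (B * w (suc t) i)) ⟩
      (r i + (Q · u t) i) + B * w (suc t) i        ≡⟨ cong (_+ B * w (suc t) i) (sym (u-step t i)) ⟩
      u (suc t) i + B * w (suc t) i                ∎
      where open ≤-Reasoning

    t*error≤B² : ∀ t i → fromℕ t * (h i - u t i) ≤ B * B
    t*error≤B² t i = begin
      fromℕ t * (h i - u t i)                    ≤⟨ *-monoˡ (÷ℕ-nonneg t 1) (+-monoˡ-≤ (- u t i) (h≤u+Bw t i)) ⟩
      fromℕ t * ((u t i + B * w t i) - u t i)    ≡⟨ solve 4 (λ t u b w → t :* ((u :+ b :* w) :- u) := b :* (t :* w)) refl
                                                      (fromℕ t) (u t i) B (w t i) ⟩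
      B * (fromℕ t * w t i)                      ≤⟨ *-monoˡ B≥0 (≤-trans (t*w≤u t i) (≤-trans (u≤h t i) (h≤B i))) ⟩
      B * B                                      ∎
      where open ≤-Reasoning

    h-isMFPT : ∀ i → IsMFPT H i j (h i)
    h-isMFPT i ε ε>0 = N , close
      where
      instance
        _ : Positive ε
        _ = positive ε>0
        _ : NonZero ε
        _ = >-nonZero ε>0
      N : ℕ
      N = proj₁ (archimedean (B * B * 1/ ε))
      B²<Nε : B * B < fromℕ N * ε
      B²<Nε = subst (_< fromℕ N * ε)
        (trans (*-assoc (B * B) (1/ ε) ε) (trans (cong (B * B *_) (*-inverseˡ ε)) (*-identityʳ (B * B))))
        (*-monoˡ-<-pos ε (proj₂ (archimedean (B * B * 1/ ε))))
      close : ∀ t → N ℕ.≤ t → ∣ u t i - h i ∣ < ε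
      close t N≤t = subst (_< ε) (sym abs) (≰⇒> λ ε≤ → <-irrefl refl (begin-strict
        B * B                      <⟨ B²<Nε ⟩
        fromℕ N * ε                ≤⟨ *-monoʳ (<⇒≤ ε>0) (fromℕ-mono N≤t) ⟩
        fromℕ t * ε                ≤⟨ *-monoˡ (÷ℕ-nonneg t 1) ε≤ ⟩
        fromℕ t * (h i - u t i)    ≤⟨ t*error≤B² t i ⟩
        B * B                      ∎))
        where
        open ≤-Reasoning
        abs : ∣ u t i - h i ∣ ≡ h i - u t i
        abs = trans (sym (∣-p∣≡∣p∣ (u t i - h i)))
          (trans (cong ∣_∣ (solve 2 (λ a b → :- (a :- b) := b :- a) refl (u t i) (h i)))
            (0≤p⇒∣p∣≡p (subst (_≤ h i - u t i) (+-inverseʳ (u t i)) (+-monoˡ-≤ (- u t i) (u≤h t i)))))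

-- The abstract block keeps the elimination from unfolding; mfpt is determined by
-- mfpt-isMFPT.  Only values with i and j in V H matter.
mfpt : ∀ {n} (H : Graph n) → Connected H → Fin n → Fin n → ℚ
mfpt-isMFPT : ∀ {n} (H : Graph n) (conn : Connected H) i {j} → j ∈ V H →
              IsMFPT H i j (mfpt H conn i j)

abstract
  mfpt H conn i j with j ∈? V H
  ... | yes j∈ = Existence.Passage.h H conn j j∈ i
  ... | no _   = 0ℚ

  mfpt-isMFPT H conn i {j} j∈ with j ∈? V H
  ... | yes j∈′ = Existence.Passage.h-isMFPT H conn j j∈′ i
  ... | no j∉   = contradiction j∈ j∉

-- The base vertex i is an argument here; κ is independent of its choice in V H.
κ : ∀ {n} (H : Graph n) → Connected H → Fin n → ℚ
κ H conn i = ∑ λ j → if does ((j ∈? V H) ×-dec ¬? (j ≟ i)) then π H j * mfpt H conn i j else 0ℚ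

α : ∀ {n} (H : Graph n) → Connected H → Fin n → ℚ
α H conn v = ∑ λ i → if does ((i ∈? V H) ×-dec ¬? (i ≟ v)) then π H i * mfpt H conn i v else 0ℚ

{-# OPTIONS --safe #-}

-- Put h(i, i) = 0 and let h(i, j) be the mean first passage time for i ≠ j.  The first-step
-- equations say that L h(·, j) = deg − 2m [· = j] for the Laplacian L.  Hence
-- i ↦ ∑ⱼ deg(j) h(i, j) = 2m κ is harmonic, so constant, on a connected graph.
-- For j ∈ G₁, summing the equations for h_G(·, j) over G₁ shows that its jump across the bridge
-- is 2m_{G₂} + 1, so its Laplacian in G₁ is deg + (2m_{G₂} + 2) [· = v₁] − 2m_G [· = j].
-- Therefore m_{G₁} h_G(·, j) + (m_{G₂} + 1) h_G(·, v₁) − m_G h_{G₁}(·, j) is harmonic on G₁;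
-- comparing its values at v₁ and j and summing over j gives
-- ∑_{j ∈ G₁} deg_{G₁}(j) h_G(v₁, j) = 2m_G κ(G₁) + 2(m_{G₂} + 1) α_{G₁}(v₁).
-- The formula is the evaluation of 2m_G κ(G) at the base vertex v₁.

module Submission where

open import Defs
open import Algebra.Bundles using (CommutativeRing)
open import Data.Bool.Base using (true; false; if_then_else_)
open import Data.Fin.Base using (Fin; zero; suc)
open import Data.Fin.Properties using (_≟_; suc-injective; <-cmp) renaming (_<?_ to _<ᶠ?_)
open import Data.Fin.Subset using (_∈_; _∉_)
open import Data.Fin.Subset.Properties using (_∈?_)
open import Data.Nat.Base using (ℕ; zero; suc) renaming (_+_ to _+ℕ_; _*_ to _*ℕ_; _⊔_ to _⊔ℕ_)
import Data.Nat.Properties as ℕₚ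
open import Data.Product.Base using (_×_; _,_; proj₁; proj₂)
open import Data.Rational.Base using (ℚ; 0ℚ; 1ℚ; ½; _+_; _*_; -_; _-_; _<_; _≤_; ∣_∣; 1/_; NonZero; ≢-nonZero)
import Data.Rational.Properties as ℚₚ
open import Data.Rational.Solver using (module +-*-Solver)
open import Data.Sum.Base using (_⊎_; inj₁; inj₂)
open import Function.Base using (_∘_)
open import Function.Bundles using (Equivalence)
open import Relation.Binary.Construct.Closure.ReflexiveTransitive using (Star; _◅_) renaming (ε to stop)
open import Relation.Binary.Definitions using (tri<; tri≈; tri>)
open import Relation.Binary.PropositionalEquality
open import Relation.Nullary using (¬_; Dec; yes; no; does; contradiction)
open import Relation.Nullary.Decidable using (_×-dec_; _⊎-dec_; ¬?; dec-true; dec-false)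

open import Algebra.Properties.Semiring.Sum (CommutativeRing.semiring ℚₚ.+-*-commutativeRing)
  using (sum-cong-≗; ∑-distrib-+; ∑-comm; *-distribˡ-sum; *-distribʳ-sum)

open Existence using (÷ℕ-+; ÷ℕ-pos; 0÷ℕ; n÷ℕn; ∑-÷ℕ; ≤-∑ℕ; ∑-zero; *-pos; fromℕ-mono; ÷ℕ-nonneg)
open +-*-Solver using (solve; _:=_; _:+_; _:*_; _:-_; :-_; con)

-- Uniqueness of limits of rational sequences.

limit-≮ : ∀ {s l l′} → Converges s l → Converges s l′ → ¬ (l < l′)
limit-≮ {s} {l} {l′} s→l s→l′ l<l′ = ℚₚ.<-irrefl refl (begin-strict
  l′ - l                          ≡⟨ solve 3 (λ s l l′ → l′ :- l := (s :- l) :- (s :- l′)) refl (s t) l l′ ⟩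
  (s t - l) - (s t - l′)          ≤⟨ p≤∣p∣ _ ⟩
  ∣ (s t - l) - (s t - l′) ∣      ≤⟨ ℚₚ.∣p-q∣≤∣p∣+∣q∣ (s t - l) (s t - l′) ⟩
  ∣ s t - l ∣ + ∣ s t - l′ ∣      <⟨ ℚₚ.+-mono-< (proj₂ (s→l ε ε>0) t (ℕₚ.m≤m⊔n N₁ N₂)) (proj₂ (s→l′ ε ε>0) t (ℕₚ.m≤n⊔m N₁ N₂)) ⟩
  ε + ε                           ≡⟨ solve 1 (λ g → con ½ :* g :+ con ½ :* g := g) refl (l′ - l) ⟩
  l′ - l                          ∎)
  where
  open ℚₚ.≤-Reasoning
  ε : ℚ
  -- Half the gap: at a time `t` beyond both thresholds the two errors are each below `ε`, so the
  -- triangle inequality would make the gap smaller than itself.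
  ε = ½ * (l′ - l)
  ε>0 : 0ℚ < ε
  ε>0 = *-pos (ℚₚ.positive⁻¹ ½) (subst (_< l′ - l) (ℚₚ.+-inverseʳ l) (ℚₚ.+-monoˡ-< (- l) l<l′))
  N₁ N₂ t : ℕ
  N₁ = proj₁ (s→l ε ε>0)
  N₂ = proj₁ (s→l′ ε ε>0)
  t  = N₁ ⊔ℕ N₂
  p≤∣p∣ : ∀ p → p ≤ ∣ p ∣
  p≤∣p∣ p with ℚₚ.≤-total 0ℚ p
  ... | inj₁ 0≤p = ℚₚ.≤-reflexive (sym (ℚₚ.0≤p⇒∣p∣≡p 0≤p))
  ... | inj₂ p≤0 = ℚₚ.≤-trans p≤0 (ℚₚ.0≤∣p∣ p)

limit-unique : ∀ {s l l′} → Converges s l → Converges s l′ → l ≡ l′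
limit-unique {s} {l} {l′} s→l s→l′ with ℚₚ.<-cmp l l′
... | tri< l<l′ _ _ = contradiction l<l′ (limit-≮ {s} s→l s→l′)
... | tri≈ _ eq _   = eq
... | tri> _ _ l′<l = contradiction l′<l (limit-≮ {s} s→l′ s→l)

open ≡-Reasoning

-- Indicators, naturals in ℚ, and finite sums.

⟦_⟧ : {A : Set} → Dec A → ℚ
⟦ d ⟧ = fromℕ (𝟙 d)

⟦⟧-yes : {A : Set} (d : Dec A) → A → ⟦ d ⟧ ≡ 1ℚ
⟦⟧-yes (yes _) a = refl
⟦⟧-yes (no ¬a) a = contradiction a ¬a

⟦⟧-no : {A : Set} (d : Dec A) → ¬ A → ⟦ d ⟧ ≡ 0ℚ
⟦⟧-no (yes a) ¬a = contradiction a ¬a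
⟦⟧-no (no _)  ¬a = refl

⟦⟧-⇔ : {A B : Set} (d : Dec A) (d′ : Dec B) → (A → B) → (B → A) → ⟦ d ⟧ ≡ ⟦ d′ ⟧
⟦⟧-⇔ (yes a) d′ to from = sym (⟦⟧-yes d′ (to a))
⟦⟧-⇔ (no ¬a) d′ to from = sym (⟦⟧-no d′ (¬a ∘ from))

abstract
  -- The Kronecker delta, sealed so that case splits on `i ≟ j` leave it intact in goals.
  𝕖 : ∀ {n} → Fin n → Fin n → ℚ
  𝕖 i j = ⟦ i ≟ j ⟧

  𝕖-refl : ∀ {n} (i : Fin n) → 𝕖 i i ≡ 1ℚ
  𝕖-refl i = ⟦⟧-yes (i ≟ i) refl

  𝕖-≢ : ∀ {n} {i j : Fin n} → i ≢ j → 𝕖 i j ≡ 0ℚ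
  𝕖-≢ {i = i} {j} = ⟦⟧-no (i ≟ j)

  𝕖-sym : ∀ {n} (i j : Fin n) → 𝕖 i j ≡ 𝕖 j i
  𝕖-sym i j = ⟦⟧-⇔ (i ≟ j) (j ≟ i) sym sym

-‿cancel : ∀ {x y} → x - y ≡ 0ℚ → x ≡ y
-‿cancel {x} {y} eq = begin
  x             ≡⟨ solve 2 (λ x y → x := (x :- y) :+ y) refl x y ⟩
  (x - y) + y   ≡⟨ cong (_+ y) eq ⟩
  0ℚ + y        ≡⟨ ℚₚ.+-identityˡ y ⟩
  y             ∎

*-cancelˡ : ∀ r {x y} → r ≢ 0ℚ → r * x ≡ r * y → x ≡ y
*-cancelˡ r {x} {y} r≢0 eq = begin
  x               ≡⟨ lemma x ⟨
  1/ r * (r * x)  ≡⟨ cong (1/ r *_) eq ⟩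
  1/ r * (r * y)  ≡⟨ lemma y ⟩
  y               ∎
  where
  instance
    _ : NonZero r
    _ = ≢-nonZero r≢0
  lemma : ∀ z → 1/ r * (r * z) ≡ z
  lemma z = trans (sym (ℚₚ.*-assoc (1/ r) r z))
    (trans (cong (_* z) (ℚₚ.*-inverseˡ r)) (ℚₚ.*-identityˡ z))

fromℕ≢0 : ∀ {a} → a ≢ 0 → fromℕ a ≢ 0ℚ
fromℕ≢0 {zero}  a≢0 _  = a≢0 refl
fromℕ≢0 {suc a} _   eq = ℚₚ.<-irrefl (sym eq) (÷ℕ-pos a 0)

fromℕ-2* : ∀ a → fromℕ (2 *ℕ a) ≡ fromℕ a + fromℕ a
fromℕ-2* a = trans (cong (λ b → fromℕ (a +ℕ b)) (ℕₚ.+-identityʳ a)) (÷ℕ-+ a a 1)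

fromℕ-* : ∀ a b → fromℕ (a *ℕ b) ≡ fromℕ a * fromℕ b
fromℕ-* zero    b = sym (ℚₚ.*-zeroˡ (fromℕ b))
fromℕ-* (suc a) b = begin
  fromℕ (b +ℕ a *ℕ b)              ≡⟨ ÷ℕ-+ b (a *ℕ b) 1 ⟩
  fromℕ b + fromℕ (a *ℕ b)         ≡⟨ cong (_+_ (fromℕ b)) (fromℕ-* a b) ⟩
  fromℕ b + fromℕ a * fromℕ b      ≡⟨ solve 2 (λ a b → b :+ a :* b := (con 1ℚ :+ a) :* b) refl (fromℕ a) (fromℕ b) ⟩
  (1ℚ + fromℕ a) * fromℕ b         ≡⟨ cong (_* fromℕ b) (÷ℕ-+ 1 a 1) ⟨
  fromℕ (suc a) * fromℕ b          ∎

-- Induction on `a` by additivity of `÷ℕ` in the numerator. It covers `d = 0` too, where both sides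
-- are 0 by convention.
fromℕ-*-1÷ℕ : ∀ a d → fromℕ a * (1 ÷ℕ d) ≡ a ÷ℕ d
fromℕ-*-1÷ℕ zero    d = trans (ℚₚ.*-zeroˡ (1 ÷ℕ d)) (sym (0÷ℕ d))
fromℕ-*-1÷ℕ (suc a) d = begin
  fromℕ (suc a) * (1 ÷ℕ d)           ≡⟨ cong (_* (1 ÷ℕ d)) (÷ℕ-+ 1 a 1) ⟩
  (1ℚ + fromℕ a) * (1 ÷ℕ d)          ≡⟨ solve 2 (λ a x → (con 1ℚ :+ a) :* x := x :+ a :* x) refl (fromℕ a) (1 ÷ℕ d) ⟩
  1 ÷ℕ d + fromℕ a * (1 ÷ℕ d)        ≡⟨ cong (_+_ (1 ÷ℕ d)) (fromℕ-*-1÷ℕ a d) ⟩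
  1 ÷ℕ d + a ÷ℕ d                    ≡⟨ ÷ℕ-+ 1 a d ⟨
  suc a ÷ℕ d                         ∎

÷ℕ-cancel : ∀ a {d} → d ≢ 0 → fromℕ d * (a ÷ℕ d) ≡ fromℕ a
÷ℕ-cancel a {zero}  d≢0 = contradiction refl d≢0
÷ℕ-cancel a {suc d} _   = begin
  fromℕ (suc d) * (a ÷ℕ suc d)                ≡⟨ cong (fromℕ (suc d) *_) (fromℕ-*-1÷ℕ a (suc d)) ⟨
  fromℕ (suc d) * (fromℕ a * (1 ÷ℕ suc d))    ≡⟨ solve 3 (λ d a x → d :* (a :* x) := a :* (d :* x)) refl (fromℕ (suc d)) (fromℕ a) (1 ÷ℕ suc d) ⟩
  fromℕ a * (fromℕ (suc d) * (1 ÷ℕ suc d))    ≡⟨ cong (fromℕ a *_) (trans (fromℕ-*-1÷ℕ (suc d) (suc d)) (n÷ℕn d)) ⟩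
  fromℕ a * 1ℚ                                ≡⟨ ℚₚ.*-identityʳ (fromℕ a) ⟩
  fromℕ a                                     ∎

∑-single : ∀ {n} (f : Fin n → ℚ) j → (∀ k → k ≢ j → f k ≡ 0ℚ) → ∑ f ≡ f j
∑-single f zero    off = trans (cong (_+_ (f zero)) (∑-zero (f ∘ suc) λ k → off (suc k) λ ()))
  (ℚₚ.+-identityʳ (f zero))
∑-single f (suc j) off = trans
  (cong₂ _+_ (off zero λ ()) (∑-single (f ∘ suc) j λ k k≢j → off (suc k) (k≢j ∘ suc-injective)))
  (ℚₚ.+-identityˡ (f (suc j)))

∑-𝕖 : ∀ {n} j (f : Fin n → ℚ) → ∑ (λ k → 𝕖 k j * f k) ≡ f j
∑-𝕖 j f = trans (∑-single (λ k → 𝕖 k j * f k) j λ k k≢j → trans (cong (_* f k) (𝕖-≢ k≢j)) (ℚₚ.*-zeroˡ (f k)))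
  (trans (cong (_* f j) (𝕖-refl j)) (ℚₚ.*-identityˡ (f j)))

∑-𝕖≡1 : ∀ {n} (j : Fin n) → ∑ (λ k → 𝕖 k j) ≡ 1ℚ
∑-𝕖≡1 j = trans (sum-cong-≗ λ k → sym (ℚₚ.*-identityʳ (𝕖 k j))) (∑-𝕖 j (λ _ → 1ℚ))

𝕖*-cong : ∀ {n} i j (f : Fin n → ℚ) → 𝕖 i j * f i ≡ 𝕖 i j * f j
𝕖*-cong i j f with i ≟ j
... | yes refl = refl
... | no i≢j   = trans (vanish i) (sym (vanish j))
  where
  vanish : ∀ k → 𝕖 i j * f k ≡ 0ℚ
  vanish k = trans (cong (_* f k) (𝕖-≢ i≢j)) (ℚₚ.*-zeroˡ (f k))

∑-distrib-*ˡ : ∀ {n} c (f : Fin n → ℚ) → ∑ (λ k → c * f k) ≡ c * ∑ f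
∑-distrib-*ˡ c f = sym (*-distribˡ-sum c f)

∑-linear : ∀ {n} p q (f g : Fin n → ℚ) → ∑ (λ k → p * f k + q * g k) ≡ p * ∑ f + q * ∑ g
∑-linear p q f g = trans (∑-distrib-+ (λ k → p * f k) (λ k → q * g k))
  (cong₂ _+_ (∑-distrib-*ˡ p f) (∑-distrib-*ˡ q g))

∑-sub : ∀ {n} (f g : Fin n → ℚ) → ∑ (λ k → f k - g k) ≡ ∑ f - ∑ g
∑-sub f g = begin
  ∑ (λ k → f k - g k)               ≡⟨ sum-cong-≗ (λ k → solve 2 (λ f g → f :- g := con 1ℚ :* f :+ (:- con 1ℚ) :* g) refl (f k) (g k)) ⟩
  ∑ (λ k → 1ℚ * f k + - 1ℚ * g k)   ≡⟨ ∑-linear 1ℚ (- 1ℚ) f g ⟩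
  1ℚ * ∑ f + - 1ℚ * ∑ g             ≡⟨ solve 2 (λ f g → con 1ℚ :* f :+ (:- con 1ℚ) :* g := f :- g) refl (∑ f) (∑ g) ⟩
  ∑ f - ∑ g                         ∎

-- Passage times as solutions of linear equations, and weighted Laplacians.

-- `mfpt` is sealed and characterised by its limit property, so uniqueness of limits is what gives
-- access to the first-step equations satisfied by `h`.
mfpt≡h : ∀ {n} (H : Graph n) conn i {j} (j∈ : j ∈ V H) →
         mfpt H conn i j ≡ Existence.Passage.h H conn j j∈ i
mfpt≡h H conn i {j} j∈ = limit-unique {λ t → 𝔼 H t i (fromℕ ∘ passage j)}
  (mfpt-isMFPT H conn i j∈) (Existence.Passage.h-isMFPT H conn j j∈ i)

-- Degree matrix minus weight matrix, written with differences. The weights are a parameter, so the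
-- Laplacians of `G` and of its components act on the same functions on `Fin n`.
Laplacian : ∀ {n} → (Fin n → Fin n → ℚ) → (Fin n → ℚ) → Fin n → ℚ
Laplacian a f i = ∑ λ k → a i k * (f i - f k)

Laplacian-cong : ∀ {n} a {f g : Fin n → ℚ} → (∀ i → f i ≡ g i) → ∀ i → Laplacian a f i ≡ Laplacian a g i
Laplacian-cong a eq i = sum-cong-≗ λ k → cong₂ (λ x y → a i k * (x - y)) (eq i) (eq k)

Laplacian-linear : ∀ {n} a p q (f g : Fin n → ℚ) i →
                   Laplacian a (λ k → p * f k + q * g k) i ≡ p * Laplacian a f i + q * Laplacian a g i
Laplacian-linear a p q f g i = trans
  (sum-cong-≗ λ k → solve 7 (λ a p q fi gi fk gk →
       a :* ((p :* fi :+ q :* gi) :- (p :* fk :+ q :* gk)) := p :* (a :* (fi :- fk)) :+ q :* (a :* (gi :- gk))) refl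
       (a i k) p q (f i) (g i) (f k) (g k))
  (∑-linear p q (λ k → a i k * (f i - f k)) (λ k → a i k * (g i - g k)))

Laplacian-∑ : ∀ {n l} a (c : Fin l → ℚ) (F : Fin n → Fin l → ℚ) i →
              Laplacian a (λ k → ∑ λ j → c j * F k j) i ≡ ∑ λ j → c j * Laplacian a (λ k → F k j) i
Laplacian-∑ a c F i = begin
  ∑ (λ k → a i k * (∑ (λ j → c j * F i j) - ∑ (λ j → c j * F k j)))
    ≡⟨ sum-cong-≗ (λ k → trans (cong (a i k *_) (sym (∑-sub (λ j → c j * F i j) (λ j → c j * F k j))))
         (sym (∑-distrib-*ˡ (a i k) (λ j → c j * F i j - c j * F k j)))) ⟩
  ∑ (λ k → ∑ (λ j → a i k * (c j * F i j - c j * F k j)))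
    ≡⟨ ∑-comm (λ k j → a i k * (c j * F i j - c j * F k j)) ⟩
  ∑ (λ j → ∑ (λ k → a i k * (c j * F i j - c j * F k j)))
    ≡⟨ sum-cong-≗ (λ j → trans
         (sum-cong-≗ λ k → solve 4 (λ a c x y → a :* (c :* x :- c :* y) := c :* (a :* (x :- y))) refl (a i k) (c j) (F i j) (F k j))
         (∑-distrib-*ˡ (c j) (λ k → a i k * (F i j - F k j)))) ⟩
  ∑ (λ j → c j * Laplacian a (λ k → F k j) i)
    ∎

-- By symmetry of the weights the terms at `(i, k)` and `(k, i)` cancel. Summing a Laplacian
-- equation over all vertices therefore leaves a balance of its sources; this determines both the
-- return time and the jump across the bridge.
∑-Laplacian : ∀ {n} a (f : Fin n → ℚ) → (∀ i k → a i k ≡ a k i) → ∑ (Laplacian a f) ≡ 0ℚ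
∑-Laplacian a f a-sym = begin
  ∑ (λ i → ∑ λ k → a i k * (f i - f k))
    ≡⟨ sum-cong-≗ (λ i → trans
         (sum-cong-≗ λ k → solve 3 (λ a x y → a :* (x :- y) := a :* x :- a :* y) refl (a i k) (f i) (f k))
         (∑-sub (λ k → a i k * f i) (λ k → a i k * f k))) ⟩
  ∑ (λ i → ∑ (λ k → a i k * f i) - ∑ (λ k → a i k * f k))
    ≡⟨ ∑-sub (λ i → ∑ (λ k → a i k * f i)) (λ i → ∑ (λ k → a i k * f k)) ⟩
  S - ∑ (λ i → ∑ (λ k → a i k * f k))
    ≡⟨ cong (_-_ S) (trans (∑-comm (λ i k → a i k * f k))
         (sum-cong-≗ λ k → sum-cong-≗ λ i → cong (_* f k) (a-sym i k))) ⟩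
  S - S
    ≡⟨ ℚₚ.+-inverseʳ S ⟩
  0ℚ
    ∎
  where S = ∑ (λ i → ∑ (λ k → a i k * f i))

-- One graph: degrees, first-step equations, maximum principle, Kemeny's constant.

module _ {n} (H : Graph n) where
  open Graph H using (_~_; _~?_; ~-sym; ~-in-V)
  open Existence.Walk H using (p; r; p≡0; adjacent⇒deg≢0)

  abstract
    -- Adjacency, degrees and the edge count are sealed so that later algebra treats them as atoms;
    -- `W≡` leads back to `m`.
    A : Fin n → Fin n → ℚ
    A i k = ⟦ i ~? k ⟧

    D : Fin n → ℚ
    D i = fromℕ (deg H i)

    W : ℚ
    W = fromℕ (m H)

    A-yes : ∀ {i k} → i ~ k → A i k ≡ 1ℚ
    A-yes {i} {k} = ⟦⟧-yes (i ~? k)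

    A-no : ∀ {i k} → ¬ (i ~ k) → A i k ≡ 0ℚ
    A-no {i} {k} = ⟦⟧-no (i ~? k)

    W≡ : W ≡ fromℕ (m H)
    W≡ = refl

    A-sym : ∀ i k → A i k ≡ A k i
    A-sym i k = ⟦⟧-⇔ (i ~? k) (k ~? i) ~-sym ~-sym

    ∑-A : ∀ i → ∑ (A i) ≡ D i
    ∑-A i = ∑-÷ℕ (λ k → 𝟙 (i ~? k)) 1

    -- Clears the denominator of the transition probability. At an isolated vertex both sides are 0,
    -- so no case distinction survives in later sums.
    D*p≡A : ∀ i k → D i * p i k ≡ A i k
    D*p≡A i k with deg H i ℕₚ.≟ 0
    ... | no d≢0  = ÷ℕ-cancel (𝟙 (i ~? k)) d≢0
    ... | yes d≡0 = trans (cong (_* p i k) (cong fromℕ d≡0))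
      (trans (ℚₚ.*-zeroˡ (p i k)) (sym (⟦⟧-no (i ~? k) λ i~k → adjacent⇒deg≢0 i~k d≡0)))

    -- Sums run over all of `Fin n`. The vanishing degree removes the indices outside `V H`, where
    -- passage times carry no meaning.
    D≡0 : ∀ {i} → i ∉ V H → D i ≡ 0ℚ
    D≡0 {i} i∉ = trans (sym (∑-A i)) (∑-zero (A i) λ k → ⟦⟧-no (i ~? k) (i∉ ∘ ~-in-V))

    -- `m` counts an edge once, at its increasing orientation, recorded by `U`. The adjacency matrix
    -- is `U` plus its transpose, so the degrees count every edge twice.
    handshake : ∑ D ≡ W + W
    handshake = begin
      ∑ D                                        ≡⟨ sum-cong-≗ (λ i → sym (∑-A i)) ⟩
      ∑ (λ i → ∑ λ j → A i j)                    ≡⟨ sum-cong-≗ (λ i → sum-cong-≗ λ j → split i j) ⟩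
      ∑ (λ i → ∑ λ j → U i j + U j i)            ≡⟨ sum-cong-≗ (λ i → ∑-distrib-+ (U i) (λ j → U j i)) ⟩
      ∑ (λ i → ∑ (U i) + ∑ λ j → U j i)          ≡⟨ ∑-distrib-+ (λ i → ∑ (U i)) (λ i → ∑ λ j → U j i) ⟩
      ∑ (λ i → ∑ (U i)) + ∑ (λ i → ∑ λ j → U j i) ≡⟨ cong (_+_ (∑ (λ i → ∑ (U i)))) (∑-comm (λ i j → U j i)) ⟩
      ∑ (λ i → ∑ (U i)) + ∑ (λ i → ∑ (U i))      ≡⟨ cong₂ _+_ ∑U ∑U ⟩
      W + W                                      ∎
      where
      U : Fin n → Fin n → ℚ
      U i j = ⟦ (i <ᶠ? j) ×-dec (i ~? j) ⟧
      ∑U : ∑ (λ i → ∑ (U i)) ≡ W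
      ∑U = trans (sum-cong-≗ λ i → ∑-÷ℕ (λ j → 𝟙 ((i <ᶠ? j) ×-dec (i ~? j))) 1)
        (∑-÷ℕ (λ i → ∑ℕ λ j → 𝟙 ((i <ᶠ? j) ×-dec (i ~? j))) 1)
      split : ∀ i j → A i j ≡ U i j + U j i
      split i j with <-cmp i j
      ... | tri< i<j _ j≮i = trans
        (⟦⟧-⇔ (i ~? j) ((i <ᶠ? j) ×-dec (i ~? j)) (i<j ,_) proj₂)
        (trans (sym (ℚₚ.+-identityʳ (U i j))) (cong (_+_ (U i j)) (sym (⟦⟧-no ((j <ᶠ? i) ×-dec (j ~? i)) (j≮i ∘ proj₁)))))
      ... | tri> i≮j _ j<i = trans
        (⟦⟧-⇔ (i ~? j) ((j <ᶠ? i) ×-dec (j ~? i)) (λ i~j → j<i , ~-sym i~j) (~-sym ∘ proj₂))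
        (trans (sym (ℚₚ.+-identityˡ (U j i))) (cong (_+ U j i) (sym (⟦⟧-no ((i <ᶠ? j) ×-dec (i ~? j)) (i≮j ∘ proj₁)))))
      ... | tri≈ i≮j refl _ = trans (⟦⟧-no (i ~? i) (Graph.~-irr H))
        (sym (cong₂ _+_ (⟦⟧-no ((i <ᶠ? i) ×-dec (i ~? i)) (i≮j ∘ proj₁)) (⟦⟧-no ((i <ᶠ? i) ×-dec (i ~? i)) (i≮j ∘ proj₁))))

    D≢0 : ∀ {i} → deg H i ≢ 0 → D i ≢ 0ℚ
    D≢0 = fromℕ≢0

    -- A single degree is at most the sum of all degrees, which is twice the edge count.
    edgeless⇒D≡0 : m H ≡ 0 → ∀ i → D i ≡ 0ℚ
    edgeless⇒D≡0 m≡0 i = ℚₚ.≤-antisym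
      (subst (D i ≤_)
        (trans (sym (∑-÷ℕ (deg H) 1)) (trans handshake (cong₂ _+_ (cong fromℕ m≡0) (cong fromℕ m≡0))))
        (fromℕ-mono (≤-∑ℕ (deg H) i)))
      (÷ℕ-nonneg (deg H i) 1)

    -- The convention `a ÷ℕ 0 = 0` decides here; it makes `κ` and `α` of a single vertex 0, as the
    -- empty sums should be.
    edgeless⇒π≡0 : m H ≡ 0 → ∀ i → π H i ≡ 0ℚ
    edgeless⇒π≡0 m≡0 i = cong (λ e → deg H i ÷ℕ (2 *ℕ e)) m≡0

    edgeless-term : m H ≡ 0 → ∀ i b x → (if b then π H i * x else 0ℚ) ≡ 0ℚ
    edgeless-term m≡0 i true  x = trans (cong (_* x) (edgeless⇒π≡0 m≡0 i)) (ℚₚ.*-zeroˡ x)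
    edgeless-term m≡0 i false x = refl

    2m*π : ∀ j → (W + W) * π H j ≡ D j
    2m*π j = trans (cong (_* π H j) (sym (fromℕ-2* (m H)))) (by-edges (m H ℕₚ.≟ 0))
      where
      by-edges : Dec (m H ≡ 0) → fromℕ (2 *ℕ m H) * π H j ≡ D j
      by-edges (no m≢0)  = ÷ℕ-cancel (deg H j) (m≢0 ∘ ℕₚ.m+n≡0⇒m≡0 (m H))
      by-edges (yes m≡0) = trans (cong (fromℕ (2 *ℕ m H) *_) (edgeless⇒π≡0 m≡0 j))
        (trans (ℚₚ.*-zeroʳ (fromℕ (2 *ℕ m H))) (sym (edgeless⇒D≡0 m≡0 j)))

  Laplacian-A : ∀ f i → Laplacian A f i ≡ D i * f i - ∑ (λ k → A i k * f k)
  Laplacian-A f i = begin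
    ∑ (λ k → A i k * (f i - f k))                      ≡⟨ sum-cong-≗ (λ k → solve 3 (λ a x y → a :* (x :- y) := a :* x :- a :* y) refl (A i k) (f i) (f k)) ⟩
    ∑ (λ k → A i k * f i - A i k * f k)                ≡⟨ ∑-sub (λ k → A i k * f i) (λ k → A i k * f k) ⟩
    ∑ (λ k → A i k * f i) - ∑ (λ k → A i k * f k)      ≡⟨ cong (_- ∑ (λ k → A i k * f k)) (trans (sym (*-distribʳ-sum (f i) (A i))) (cong (_* f i) (∑-A i))) ⟩
    D i * f i - ∑ (λ k → A i k * f k)                  ∎

  Laplacian-outside : ∀ f {i} → i ∉ V H → Laplacian A f i ≡ 0ℚ
  Laplacian-outside f {i} i∉ = ∑-zero (λ k → A i k * (f i - f k)) λ k →
    trans (cong (_* (f i - f k)) (A-no (i∉ ∘ ~-in-V))) (ℚₚ.*-zeroˡ (f i - f k))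

  module _ (conn : Connected H) where

    abstract
      -- `passage` counts from the first step, so `mfpt` on the diagonal is the mean return time.
      -- Resetting the diagonal to 0 gives the function whose Laplacian has its only pole at the
      -- target.
      hit : Fin n → Fin n → ℚ
      hit i j = if does (i ≟ j) then 0ℚ else mfpt H conn i j

      hit-refl : ∀ j → hit j j ≡ 0ℚ
      hit-refl j with j ≟ j
      ... | yes _  = refl
      ... | no j≢j = contradiction refl j≢j

      hit-≢ : ∀ {i j} → i ≢ j → hit i j ≡ mfpt H conn i j
      hit-≢ {i} {j} i≢j with i ≟ j
      ... | yes i≡j = contradiction i≡j i≢j
      ... | no _    = refl

    -- The first-step equations give this with the degree-weighted return time `D j * h j` in place
    -- of `W + W`. Since a Laplacian sums to 0, that constant must equal the total degree: Kac's
    -- formula for the return time.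
    Laplacian-hit : ∀ {j} → j ∈ V H → ∀ i → Laplacian A (λ k → hit k j) i ≡ D i - (W + W) * 𝕖 i j
    Laplacian-hit {j} j∈ i = trans (pre i) (cong (λ c → D i - c * 𝕖 i j) (sym return-time))
      where
      open Existence.Passage H conn j j∈ using (h; h-eq; Q)
      x : Fin n → ℚ
      x k = hit k j
      -- `Q` deletes steps into the target, whereas `x` vanishes at the target; the two devices give
      -- the same sum.
      Q*h : ∀ i k → Q i k * h k ≡ p i k * x k
      Q*h i k with k ≟ j
      ... | yes refl = trans (ℚₚ.*-zeroˡ (h k)) (sym (trans (cong (p i k *_) (hit-refl k)) (ℚₚ.*-zeroʳ (p i k))))
      ... | no k≢j   = cong (p i k *_) (sym (trans (hit-≢ k≢j) (mfpt≡h H conn k j∈)))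
      first-step : ∀ i → D i * h i ≡ D i + ∑ (λ k → A i k * x k)
      first-step i = begin
        D i * h i
          ≡⟨ cong (D i *_) (trans (h-eq i) (cong (_+_ (r i)) (sum-cong-≗ (Q*h i)))) ⟩
        D i * (r i + ∑ (λ k → p i k * x k))
          ≡⟨ ℚₚ.*-distribˡ-+ (D i) (r i) _ ⟩
        D i * r i + D i * ∑ (λ k → p i k * x k)
          ≡⟨ cong₂ _+_
               (trans (*-distribˡ-sum (D i) (p i)) (trans (sum-cong-≗ (D*p≡A i)) (∑-A i)))
               (trans (*-distribˡ-sum (D i) (λ k → p i k * x k))
                 (sum-cong-≗ λ k → trans (sym (ℚₚ.*-assoc (D i) (p i k) (x k))) (cong (_* x k) (D*p≡A i k)))) ⟩
        D i + ∑ (λ k → A i k * x k)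
          ∎
      -- `x` and `h` differ only at `j`, by the return time `h j`.
      x≡ : ∀ i → D i * x i ≡ D i * h i - (D j * h j) * 𝕖 i j
      x≡ i with i ≟ j
      ... | yes refl = begin
        D i * hit i i                            ≡⟨ cong (D i *_) (hit-refl i) ⟩
        D i * 0ℚ                                 ≡⟨ solve 2 (λ d h → d :* con 0ℚ := d :* h :- (d :* h) :* con 1ℚ) refl (D i) (h i) ⟩
        D i * h i - (D i * h i) * 1ℚ             ≡⟨ cong (λ e → D i * h i - (D i * h i) * e) (𝕖-refl i) ⟨
        D i * h i - (D i * h i) * 𝕖 i i          ∎
      ... | no i≢j = begin
        D i * hit i j                            ≡⟨ cong (D i *_) (trans (hit-≢ i≢j) (mfpt≡h H conn i j∈)) ⟩
        D i * h i                                ≡⟨ solve 2 (λ z c → z := z :- c :* con 0ℚ) refl (D i * h i) (D j * h j) ⟩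
        D i * h i - (D j * h j) * 0ℚ             ≡⟨ cong (λ e → D i * h i - (D j * h j) * e) (𝕖-≢ i≢j) ⟨
        D i * h i - (D j * h j) * 𝕖 i j          ∎
      pre : ∀ i → Laplacian A x i ≡ D i - (D j * h j) * 𝕖 i j
      pre i = begin
        Laplacian A x i                                              ≡⟨ Laplacian-A x i ⟩
        D i * x i - S                                                ≡⟨ cong (_- S) (x≡ i) ⟩
        (D i * h i - (D j * h j) * 𝕖 i j) - S                        ≡⟨ cong (λ z → (z - (D j * h j) * 𝕖 i j) - S) (first-step i) ⟩
        ((D i + S) - (D j * h j) * 𝕖 i j) - S                        ≡⟨ solve 3 (λ d s c → ((d :+ s) :- c) :- s := d :- c) refl (D i) S ((D j * h j) * 𝕖 i j) ⟩
        D i - (D j * h j) * 𝕖 i j                                    ∎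
        where S = ∑ (λ k → A i k * x k)
      return-time : W + W ≡ D j * h j
      return-time = trans (sym handshake) (-‿cancel (begin
        ∑ D - D j * h j                          ≡⟨ cong (_-_ (∑ D)) (∑-𝕖 j (λ _ → D j * h j)) ⟨
        ∑ D - ∑ (λ i → 𝕖 i j * (D j * h j))      ≡⟨ cong (_-_ (∑ D)) (sum-cong-≗ λ i → ℚₚ.*-comm (𝕖 i j) (D j * h j)) ⟩
        ∑ D - ∑ (λ i → (D j * h j) * 𝕖 i j)      ≡⟨ ∑-sub D (λ i → (D j * h j) * 𝕖 i j) ⟨
        ∑ (λ i → D i - (D j * h j) * 𝕖 i j)      ≡⟨ sum-cong-≗ pre ⟨
        ∑ (Laplacian A x)                        ≡⟨ ∑-Laplacian A x A-sym ⟩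
        0ℚ                                       ∎))

    -- The maximum principle for the walk killed at `j`: since `f - f j` vanishes at `j`, it is
    -- fixed by `Q`, hence both subharmonic and superharmonic, hence 0.
    harmonic⇒constant : ∀ f → (∀ i → Laplacian A f i ≡ 0ℚ) → ∀ {i j} → i ∈ V H → j ∈ V H → f i ≡ f j
    harmonic⇒constant f harm {i} {j} i∈ j∈ = by-path (Connected.joined conn i∈ j∈)
      where
      open Existence.Passage H conn j j∈ using (Q; Q-isolated; subharmonic≤0; superharmonic≥0)
      open Existence using (_·_)
      x : Fin n → ℚ
      -- `Q · x` is 0 at an isolated index, such as any index outside `V H`, while `f k - f j` is
      -- arbitrary there; the reset to 0 makes `x` a fixed point everywhere.
      x k = if does (deg H k ℕₚ.≟ 0) then 0ℚ else f k - f j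
      x-isolated : ∀ {k} → deg H k ≡ 0 → x k ≡ 0ℚ
      x-isolated {k} eq = cong (λ b → if b then 0ℚ else f k - f j) (dec-true (deg H k ℕₚ.≟ 0) eq)
      x-joined : ∀ {k} → deg H k ≢ 0 → x k ≡ f k - f j
      x-joined {k} ne = cong (λ b → if b then 0ℚ else f k - f j) (dec-false (deg H k ℕₚ.≟ 0) ne)
      Q*x : ∀ i k → Q i k * x k ≡ p i k * (f k - f j)
      Q*x i k with k ≟ j
      ... | yes refl = trans (ℚₚ.*-zeroˡ (x k)) (sym (trans (cong (p i k *_) (ℚₚ.+-inverseʳ (f k))) (ℚₚ.*-zeroʳ (p i k))))
      ... | no _ with deg H k ℕₚ.≟ 0
      ...   | no ne  = cong (p i k *_) (x-joined ne)
      ...   | yes eq = trans (cong (p i k *_) (x-isolated eq)) (trans (ℚₚ.*-zeroʳ (p i k)) (sym (trans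
        (cong (_* (f k - f j)) (p≡0 λ i~k → adjacent⇒deg≢0 (~-sym i~k) eq)) (ℚₚ.*-zeroˡ (f k - f j)))))
      mean : ∀ i → deg H i ≢ 0 → ∑ (λ k → p i k * (f k - f j)) ≡ f i - f j
      mean i ne = *-cancelˡ (D i) (D≢0 ne) (begin
        D i * ∑ (λ k → p i k * (f k - f j))                    ≡⟨ *-distribˡ-sum (D i) (λ k → p i k * (f k - f j)) ⟩
        ∑ (λ k → D i * (p i k * (f k - f j)))                  ≡⟨ sum-cong-≗ (λ k → trans (sym (ℚₚ.*-assoc (D i) (p i k) _)) (cong (_* (f k - f j)) (D*p≡A i k))) ⟩
        ∑ (λ k → A i k * (f k - f j))                          ≡⟨ sum-cong-≗ (λ k → solve 4 (λ a x y z → a :* (y :- z) := a :* (x :- z) :- a :* (x :- y)) refl (A i k) (f i) (f k) (f j)) ⟩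
        ∑ (λ k → A i k * (f i - f j) - A i k * (f i - f k))    ≡⟨ ∑-sub (λ k → A i k * (f i - f j)) (λ k → A i k * (f i - f k)) ⟩
        ∑ (λ k → A i k * (f i - f j)) - Laplacian A f i        ≡⟨ cong₂ _-_ (trans (sym (*-distribʳ-sum (f i - f j) (A i))) (cong (_* (f i - f j)) (∑-A i))) (harm i) ⟩
        D i * (f i - f j) - 0ℚ                                 ≡⟨ ℚₚ.+-identityʳ _ ⟩
        D i * (f i - f j)                                      ∎)
      fixed : ∀ i → (Q · x) i ≡ x i
      fixed i with deg H i ℕₚ.≟ 0
      ... | yes d≡0 = trans (Q-isolated d≡0 x) (sym (x-isolated d≡0))
      ... | no d≢0  = trans (sum-cong-≗ (Q*x i)) (trans (mean i d≢0) (sym (x-joined d≢0)))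
      x≡0 : ∀ i → x i ≡ 0ℚ
      x≡0 i = ℚₚ.≤-antisym (subharmonic≤0 x (ℚₚ.≤-reflexive ∘ sym ∘ fixed) i)
                           (superharmonic≥0 x (ℚₚ.≤-reflexive ∘ fixed) i)
      by-path : ∀ {i} → Star _~_ i j → f i ≡ f j
      by-path stop = refl
      -- The first edge of the path shows that `i` is not isolated, so `x i` is the genuine
      -- difference `f i - f j`.
      by-path {i} (i~k ◅ _) = -‿cancel (trans (sym (x-joined (adjacent⇒deg≢0 i~k))) (x≡0 i))

    kemeny : Fin n → ℚ
    kemeny i = ∑ λ j → D j * hit i j

    -- Superpose the columns of `hit` with weights `D j`: the uniform sources add up to
    -- `D i * (W + W)`, and the pole at `j = i` removes exactly this amount.
    kemeny-constant : ∀ {i i′} → i ∈ V H → i′ ∈ V H → kemeny i ≡ kemeny i′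
    kemeny-constant = harmonic⇒constant kemeny λ i → begin
      Laplacian A kemeny i                                         ≡⟨ Laplacian-∑ A D hit i ⟩
      ∑ (λ j → D j * Laplacian A (λ k → hit k j) i)                ≡⟨ sum-cong-≗ (column i) ⟩
      ∑ (λ j → D i * D j - (W + W) * (𝕖 j i * D j))                ≡⟨ ∑-sub (λ j → D i * D j) (λ j → (W + W) * (𝕖 j i * D j)) ⟩
      ∑ (λ j → D i * D j) - ∑ (λ j → (W + W) * (𝕖 j i * D j))      ≡⟨ cong₂ _-_
                                                                        (trans (∑-distrib-*ˡ (D i) D) (cong (D i *_) handshake))
                                                                        (trans (∑-distrib-*ˡ (W + W) (λ j → 𝕖 j i * D j)) (cong ((W + W) *_) (∑-𝕖 i D))) ⟩
      D i * (W + W) - (W + W) * D i                                ≡⟨ solve 2 (λ d w → d :* (w :+ w) :- (w :+ w) :* d := con 0ℚ) refl (D i) W ⟩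
      0ℚ                                                           ∎
      where
      column : ∀ i j → D j * Laplacian A (λ k → hit k j) i ≡ D i * D j - (W + W) * (𝕖 j i * D j)
      column i j with j ∈? V H
      ... | yes j∈ = trans (cong (D j *_) (trans (Laplacian-hit j∈ i)
                       (cong (λ e → D i - (W + W) * e) (𝕖-sym i j))))
                     (solve 4 (λ dj di w e → dj :* (di :- w :* e) := di :* dj :- w :* (e :* dj)) refl (D j) (D i) (W + W) (𝕖 j i))
      -- `Laplacian-hit` says nothing about a target outside `V H`, but its weight `D j` is 0.
      ... | no j∉ = begin
        D j * Laplacian A (λ k → hit k j) i          ≡⟨ cong (_* Laplacian A (λ k → hit k j) i) (D≡0 j∉) ⟩
        0ℚ * Laplacian A (λ k → hit k j) i           ≡⟨ solve 4 (λ l d w e → con 0ℚ :* l := d :* con 0ℚ :- w :* (e :* con 0ℚ)) refl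
                                                          (Laplacian A (λ k → hit k j) i) (D i) (W + W) (𝕖 j i) ⟩
        D i * 0ℚ - (W + W) * (𝕖 j i * 0ℚ)            ≡⟨ cong (λ d → D i * d - (W + W) * (𝕖 j i * d)) (D≡0 j∉) ⟨
        D i * D j - (W + W) * (𝕖 j i * D j)          ∎

    -- Common to `κ` and `α`. The guard drops the base vertex and the indices outside `V H`; on the
    -- right the same terms vanish through `c′` and `D`.
    2m*∑π : ∀ i (c c′ : Fin n → ℚ) → c′ i ≡ 0ℚ → (∀ j → j ≢ i → c′ j ≡ c j) →
            (W + W) * ∑ (λ j → if does ((j ∈? V H) ×-dec ¬? (j ≟ i)) then π H j * c j else 0ℚ) ≡ ∑ λ j → D j * c′ j
    2m*∑π i c c′ c′i≡0 c′≡c = trans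
      (*-distribˡ-sum (W + W) (λ j → if does ((j ∈? V H) ×-dec ¬? (j ≟ i)) then π H j * c j else 0ℚ))
      (sum-cong-≗ term)
      where
      term : ∀ j → (W + W) * (if does ((j ∈? V H) ×-dec ¬? (j ≟ i)) then π H j * c j else 0ℚ) ≡ D j * c′ j
      term j with j ∈? V H | j ≟ i
      ... | yes _ | yes refl = trans (ℚₚ.*-zeroʳ (W + W)) (sym (trans (cong (D j *_) c′i≡0) (ℚₚ.*-zeroʳ (D j))))
      ... | yes _ | no j≢i   = trans (sym (ℚₚ.*-assoc (W + W) (π H j) (c j))) (cong₂ _*_ (2m*π j) (sym (c′≡c j j≢i)))
      ... | no j∉ | _        = trans (ℚₚ.*-zeroʳ (W + W)) (sym (trans (cong (_* c′ j) (D≡0 j∉)) (ℚₚ.*-zeroˡ (c′ j))))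

    2m*κ : ∀ i → (W + W) * κ H conn i ≡ kemeny i
    2m*κ i = 2m*∑π i (mfpt H conn i) (hit i) (hit-refl i) λ j j≢i → hit-≢ (j≢i ∘ sym)

    2m*α : ∀ v → (W + W) * α H conn v ≡ ∑ (λ i → D i * hit i v)
    2m*α v = 2m*∑π v (λ i → mfpt H conn i v) (λ i → hit i v) (hit-refl v) λ i → hit-≢

    edgeless⇒κ≡0 : m H ≡ 0 → ∀ i → κ H conn i ≡ 0ℚ
    edgeless⇒κ≡0 m≡0 i = ∑-zero (λ j → if does ((j ∈? V H) ×-dec ¬? (j ≟ i)) then π H j * mfpt H conn i j else 0ℚ) term
      where
      term : ∀ j → (if does ((j ∈? V H) ×-dec ¬? (j ≟ i)) then π H j * mfpt H conn i j else 0ℚ) ≡ 0ℚ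
      term j = edgeless-term m≡0 j (does ((j ∈? V H) ×-dec ¬? (j ≟ i))) (mfpt H conn i j)

    edgeless⇒α≡0 : m H ≡ 0 → ∀ v → α H conn v ≡ 0ℚ
    edgeless⇒α≡0 m≡0 v = ∑-zero (λ i → if does ((i ∈? V H) ×-dec ¬? (i ≟ v)) then π H i * mfpt H conn i v else 0ℚ) term
      where
      term : ∀ i → (if does ((i ∈? V H) ×-dec ¬? (i ≟ v)) then π H i * mfpt H conn i v else 0ℚ) ≡ 0ℚ
      term i = edgeless-term m≡0 i (does ((i ∈? V H) ×-dec ¬? (i ≟ v))) (mfpt H conn i v)

-- Decomposition of a graph along a bridge.

-- The interface between combinatorics and algebra: the adjacency matrix of `G` is that of the two
-- sides plus the two entries of the bridge. It is symmetric in the sides, so facts proved for `G₁`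
-- transfer to `G₂` by `Split-sym`.
record Split {n} (G G₁ G₂ : Graph n) (v₁ v₂ : Fin n) : Set where
  field
    inside₁  : ∀ {i} → i ∈ V G₁ → i ∈ V G
    inside₂  : ∀ {i} → i ∈ V G₂ → i ∈ V G
    disjoint : ∀ {i} → i ∈ V G₁ → i ∉ V G₂
    v₁∈      : v₁ ∈ V G₁
    v₂∈      : v₂ ∈ V G₂
    adjacent : ∀ i k → A G i k ≡ A G₁ i k + A G₂ i k + (𝕖 i v₁ * 𝕖 k v₂ + 𝕖 i v₂ * 𝕖 k v₁)

Split-sym : ∀ {n} {G G₁ G₂ : Graph n} {v₁ v₂} → Split G G₁ G₂ v₁ v₂ → Split G G₂ G₁ v₂ v₁
Split-sym {G₁ = G₁} {G₂} {v₁} {v₂} split = record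
  { inside₁  = inside₂
  ; inside₂  = inside₁
  ; disjoint = λ i∈₂ i∈₁ → disjoint i∈₁ i∈₂
  ; v₁∈      = v₂∈
  ; v₂∈      = v₁∈
  ; adjacent = λ i k → trans (adjacent i k)
      (cong₂ _+_ (ℚₚ.+-comm (A G₁ i k) (A G₂ i k)) (ℚₚ.+-comm (𝕖 i v₁ * 𝕖 k v₂) (𝕖 i v₂ * 𝕖 k v₁)))
  }
  where open Split split

module _ {n} (G G₁ G₂ : Graph n) (v₁ v₂ : Fin n) (conn : Connected G) (isBridge : IsBridge G v₁ v₂)
         (comp₁ : IsComponent G₁ (G ∖⟨ v₁ , v₂ ⟩)) (v₁∈ : v₁ ∈ V G₁)
         (comp₂ : IsComponent G₂ (G ∖⟨ v₁ , v₂ ⟩)) (v₂∈ : v₂ ∈ V G₂) where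
  open Graph G using (_~_; _~?_; ~-sym)
  private
    module C₁ = IsComponent comp₁
    module C₂ = IsComponent comp₂
    IsEdge : Fin n → Fin n → Set
    IsEdge u w = u ≡ v₁ × w ≡ v₂ ⊎ u ≡ v₂ × w ≡ v₁
    isEdge? : ∀ u w → Dec (IsEdge u w)
    isEdge? u w = ((u ≟ v₁) ×-dec (w ≟ v₂)) ⊎-dec ((u ≟ v₂) ×-dec (w ≟ v₁))

  component-step : ∀ {C} (isC : IsComponent C (G ∖⟨ v₁ , v₂ ⟩)) {u w} → u ∈ V C → u ~ w → ¬ IsEdge u w → w ∈ V C
  component-step isC {w = w} u∈ u~w ne = Equivalence.from (IsComponent.class isC u∈ w) ((u~w , ne) ◅ stop)

  -- Induction along the path: crossing the bridge lands on `v₁` or `v₂`, and any other edge stays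
  -- inside its component.
  cover : ∀ {u w} → Star _~_ u w → u ∈ V G₁ ⊎ u ∈ V G₂ → w ∈ V G₁ ⊎ w ∈ V G₂
  cover stop u∈ = u∈
  cover {u} (_◅_ {j = k} u~k rest) u∈ with isEdge? u k
  ... | yes (inj₁ (_ , refl)) = cover rest (inj₂ v₂∈)
  ... | yes (inj₂ (_ , refl)) = cover rest (inj₁ v₁∈)
  ... | no ne with u∈
  ...   | inj₁ u∈₁ = cover rest (inj₁ (component-step comp₁ u∈₁ u~k ne))
  ...   | inj₂ u∈₂ = cover rest (inj₂ (component-step comp₂ u∈₂ u~k ne))

  covered : ∀ {w} → w ∈ V G → w ∈ V G₁ ⊎ w ∈ V G₂
  covered w∈ = cover (Connected.joined conn (C₁.inside v₁∈) w∈) (inj₁ v₁∈)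

  -- A common vertex would merge the two classes, so all of `V G` would lie in the class of `v₁`,
  -- and deleting the bridge would leave a connected graph.
  components-disjoint : ∀ {i} → i ∈ V G₁ → i ∉ V G₂
  components-disjoint {i} i∈₁ i∈₂ = IsBridge.disconnected isBridge record
    { nonempty = v₁ , C₁.inside v₁∈
    ; joined   = λ {u} {w} u∈ w∈ → Equivalence.to (C₁.class (in₁ u∈) w) (in₁ w∈)
    }
    where
    in₁ : ∀ {w} → w ∈ V G → w ∈ V G₁
    in₁ {w} w∈ with covered w∈
    ... | inj₁ w∈₁ = w∈₁
    ... | inj₂ w∈₂ = Equivalence.from (C₁.class i∈₁ w) (Equivalence.to (C₂.class i∈₂ w) w∈₂)

  bridge-split : Split G G₁ G₂ v₁ v₂
  bridge-split = record
    { inside₁ = C₁.inside ; inside₂ = C₂.inside ; disjoint = components-disjoint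
    ; v₁∈ = v₁∈ ; v₂∈ = v₂∈ ; adjacent = adjacent }
    where
    v₁∉₂ : v₁ ∉ V G₂
    v₁∉₂ = components-disjoint v₁∈
    v₂∉₁ : v₂ ∉ V G₁
    v₂∉₁ v₂∈₁ = components-disjoint v₂∈₁ v₂∈
    v₁≢v₂ : v₁ ≢ v₂
    v₁≢v₂ refl = v₁∉₂ v₂∈

    no-edge : ∀ {C} (isC : IsComponent C (G ∖⟨ v₁ , v₂ ⟩)) {i k} → ¬ (i ~ k × ¬ IsEdge i k) → A C i k ≡ 0ℚ
    no-edge {C} isC {i} {k} ne = A-no C λ i~k → ne (proj₂ (proj₂ (Equivalence.to (IsComponent.induced isC i k) i~k)))

    outside : ∀ {C : Graph n} {i k} → i ∉ V C → A C i k ≡ 0ℚ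
    outside {C} {i} {k} i∉ = A-no C (i∉ ∘ Graph.~-in-V C)

    same-edge : ∀ {C} (isC : IsComponent C (G ∖⟨ v₁ , v₂ ⟩)) {i k} → i ∈ V C → ¬ IsEdge i k → A G i k ≡ A C i k
    same-edge {C} isC {i} {k} i∈ ne with i ~? k
    ... | yes i~k = trans (A-yes G i~k) (sym (A-yes C
      (Equivalence.from (IsComponent.induced isC i k) (i∈ , component-step isC i∈ i~k ne , i~k , ne))))
    ... | no i≁k  = trans (A-no G i≁k) (sym (no-edge isC (i≁k ∘ proj₁)))

    old-edges : ∀ i k → ¬ IsEdge i k → A G i k ≡ A G₁ i k + A G₂ i k
    old-edges i k ne with i ∈? V G
    ... | no i∉ = trans (outside i∉) (sym (cong₂ _+_ (outside (i∉ ∘ C₁.inside)) (outside (i∉ ∘ C₂.inside))))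
    ... | yes i∈ with covered i∈
    ...   | inj₁ i∈₁ = trans (same-edge comp₁ i∈₁ ne)
      (trans (sym (ℚₚ.+-identityʳ (A G₁ i k))) (cong (_+_ (A G₁ i k)) (sym (outside (components-disjoint i∈₁)))))
    ...   | inj₂ i∈₂ = trans (same-edge comp₂ i∈₂ ne)
      (trans (sym (ℚₚ.+-identityˡ (A G₂ i k))) (cong (_+ A G₂ i k) (sym (outside λ i∈₁ → components-disjoint i∈₁ i∈₂))))

    𝕖𝕖≡0 : ∀ i k a b → ¬ (i ≡ a × k ≡ b) → 𝕖 i a * 𝕖 k b ≡ 0ℚ
    𝕖𝕖≡0 i k a b ne with i ≟ a
    ... | yes i≡a = trans (cong (𝕖 i a *_) (𝕖-≢ λ k≡b → ne (i≡a , k≡b))) (ℚₚ.*-zeroʳ (𝕖 i a))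
    ... | no i≢a  = trans (cong (_* 𝕖 k b) (𝕖-≢ i≢a)) (ℚₚ.*-zeroˡ (𝕖 k b))

    𝕖𝕖≡1 : ∀ (a b : Fin n) → 𝕖 a a * 𝕖 b b ≡ 1ℚ
    𝕖𝕖≡1 a b = cong₂ _*_ (𝕖-refl a) (𝕖-refl b)

    edge : ∀ i k → IsEdge i k → A G i k ≡ A G₁ i k + A G₂ i k + (𝕖 i v₁ * 𝕖 k v₂ + 𝕖 i v₂ * 𝕖 k v₁)
    edge i k e = trans (A-yes G (i~k e)) (sym (cong₂ _+_
      (cong₂ _+_ (no-edge comp₁ λ (_ , ne) → ne e) (no-edge comp₂ λ (_ , ne) → ne e)) (new e)))
      where
      i~k : IsEdge i k → i ~ k
      i~k (inj₁ (refl , refl)) = IsBridge.edge isBridge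
      i~k (inj₂ (refl , refl)) = ~-sym (IsBridge.edge isBridge)
      new : IsEdge i k → 𝕖 i v₁ * 𝕖 k v₂ + 𝕖 i v₂ * 𝕖 k v₁ ≡ 1ℚ
      new (inj₁ (refl , refl)) = cong₂ _+_ (𝕖𝕖≡1 v₁ v₂) (𝕖𝕖≡0 v₁ v₂ v₂ v₁ (v₁≢v₂ ∘ proj₁))
      new (inj₂ (refl , refl)) = cong₂ _+_ (𝕖𝕖≡0 v₂ v₁ v₁ v₂ (v₁≢v₂ ∘ proj₂)) (𝕖𝕖≡1 v₂ v₁)

    adjacent : ∀ i k → A G i k ≡ A G₁ i k + A G₂ i k + (𝕖 i v₁ * 𝕖 k v₂ + 𝕖 i v₂ * 𝕖 k v₁)
    adjacent i k with isEdge? i k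
    ... | yes e = edge i k e
    ... | no ne = trans (old-edges i k ne) (trans (sym (ℚₚ.+-identityʳ (A G₁ i k + A G₂ i k)))
      (cong (_+_ (A G₁ i k + A G₂ i k)) (sym (cong₂ _+_ (𝕖𝕖≡0 i k v₁ v₂ (ne ∘ inj₁)) (𝕖𝕖≡0 i k v₂ v₁ (ne ∘ inj₂))))))

-- Passage times of `G` seen from one side of the bridge.

module _ {n} {G G₁ G₂ : Graph n} {v₁ v₂ : Fin n} (split : Split G G₁ G₂ v₁ v₂) where
  open Split split

  private
    v₂∉₁ : v₂ ∉ V G₁
    v₂∉₁ v₂∈₁ = disjoint v₂∈₁ v₂∈

  D-split : ∀ i → D G i ≡ D G₁ i + D G₂ i + (𝕖 i v₁ + 𝕖 i v₂)
  D-split i = begin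
    D G i                                                                       ≡⟨ ∑-A G i ⟨
    ∑ (A G i)                                                                   ≡⟨ sum-cong-≗ (adjacent i) ⟩
    ∑ (λ k → A G₁ i k + A G₂ i k + bridge k)                                    ≡⟨ ∑-distrib-+ (λ k → A G₁ i k + A G₂ i k) bridge ⟩
    ∑ (λ k → A G₁ i k + A G₂ i k) + ∑ bridge                                    ≡⟨ cong₂ _+_
                                                                                     (trans (∑-distrib-+ (A G₁ i) (A G₂ i)) (cong₂ _+_ (∑-A G₁ i) (∑-A G₂ i)))
                                                                                     (∑-linear (𝕖 i v₁) (𝕖 i v₂) (λ k → 𝕖 k v₂) (λ k → 𝕖 k v₁)) ⟩
    D G₁ i + D G₂ i + (𝕖 i v₁ * ∑ (λ k → 𝕖 k v₂) + 𝕖 i v₂ * ∑ (λ k → 𝕖 k v₁))   ≡⟨ cong (_+_ (D G₁ i + D G₂ i)) (cong₂ _+_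
                                                                                     (trans (cong (𝕖 i v₁ *_) (∑-𝕖≡1 v₂)) (ℚₚ.*-identityʳ (𝕖 i v₁)))
                                                                                     (trans (cong (𝕖 i v₂ *_) (∑-𝕖≡1 v₁)) (ℚₚ.*-identityʳ (𝕖 i v₂)))) ⟩
    D G₁ i + D G₂ i + (𝕖 i v₁ + 𝕖 i v₂)                                         ∎
    where
    bridge : Fin n → ℚ
    bridge k = 𝕖 i v₁ * 𝕖 k v₂ + 𝕖 i v₂ * 𝕖 k v₁

  -- Obtained from the degrees through the handshake identity, which avoids the ordered pairs in the
  -- definition of `m`.
  W-split : W G ≡ W G₁ + W G₂ + 1ℚ
  W-split = *-cancelˡ (1ℚ + 1ℚ) (λ ()) (begin
    (1ℚ + 1ℚ) * W G                                          ≡⟨ double (W G) ⟩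
    W G + W G                                                ≡⟨ handshake G ⟨
    ∑ (D G)                                                  ≡⟨ sum-cong-≗ D-split ⟩
    ∑ (λ i → D G₁ i + D G₂ i + (𝕖 i v₁ + 𝕖 i v₂))            ≡⟨ ∑-distrib-+ (λ i → D G₁ i + D G₂ i) (λ i → 𝕖 i v₁ + 𝕖 i v₂) ⟩
    ∑ (λ i → D G₁ i + D G₂ i) + ∑ (λ i → 𝕖 i v₁ + 𝕖 i v₂)    ≡⟨ cong₂ _+_
                                                                  (trans (∑-distrib-+ (D G₁) (D G₂)) (cong₂ _+_ (handshake G₁) (handshake G₂)))
                                                                  (trans (∑-distrib-+ (λ i → 𝕖 i v₁) (λ i → 𝕖 i v₂)) (cong₂ _+_ (∑-𝕖≡1 v₁) (∑-𝕖≡1 v₂))) ⟩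
    ((W G₁ + W G₁) + (W G₂ + W G₂)) + (1ℚ + 1ℚ)              ≡⟨ solve 2 (λ a b → ((a :+ a) :+ (b :+ b)) :+ (con 1ℚ :+ con 1ℚ)
                                                                       := (con 1ℚ :+ con 1ℚ) :* (a :+ b :+ con 1ℚ)) refl (W G₁) (W G₂) ⟩
    (1ℚ + 1ℚ) * (W G₁ + W G₂ + 1ℚ)                           ∎)
    where
    double : ∀ x → (1ℚ + 1ℚ) * x ≡ x + x
    double = solve 1 (λ x → (con 1ℚ :+ con 1ℚ) :* x := x :+ x) refl

  Laplacian-split : ∀ f i → Laplacian (A G) f i ≡
                    Laplacian (A G₁) f i + Laplacian (A G₂) f i + (𝕖 i v₁ * (f i - f v₂) + 𝕖 i v₂ * (f i - f v₁))
  Laplacian-split f i = begin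
    ∑ (λ k → A G i k * Δ k)
      ≡⟨ sum-cong-≗ (λ k → trans (cong (_* Δ k) (adjacent i k))
           (solve 7 (λ a b x y z w d → (a :+ b :+ (x :* y :+ z :* w)) :* d := (a :* d :+ b :* d) :+ (x :* (y :* d) :+ z :* (w :* d))) refl
             (A G₁ i k) (A G₂ i k) (𝕖 i v₁) (𝕖 k v₂) (𝕖 i v₂) (𝕖 k v₁) (Δ k))) ⟩
    ∑ (λ k → (A G₁ i k * Δ k + A G₂ i k * Δ k) + (𝕖 i v₁ * (𝕖 k v₂ * Δ k) + 𝕖 i v₂ * (𝕖 k v₁ * Δ k)))
      ≡⟨ ∑-distrib-+ (λ k → A G₁ i k * Δ k + A G₂ i k * Δ k) (λ k → 𝕖 i v₁ * (𝕖 k v₂ * Δ k) + 𝕖 i v₂ * (𝕖 k v₁ * Δ k)) ⟩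
    ∑ (λ k → A G₁ i k * Δ k + A G₂ i k * Δ k) + ∑ (λ k → 𝕖 i v₁ * (𝕖 k v₂ * Δ k) + 𝕖 i v₂ * (𝕖 k v₁ * Δ k))
      ≡⟨ cong₂ _+_ (∑-distrib-+ (λ k → A G₁ i k * Δ k) (λ k → A G₂ i k * Δ k))
           (trans (∑-linear (𝕖 i v₁) (𝕖 i v₂) (λ k → 𝕖 k v₂ * Δ k) (λ k → 𝕖 k v₁ * Δ k))
             (cong₂ (λ x y → 𝕖 i v₁ * x + 𝕖 i v₂ * y) (∑-𝕖 v₂ Δ) (∑-𝕖 v₁ Δ))) ⟩
    Laplacian (A G₁) f i + Laplacian (A G₂) f i + (𝕖 i v₁ * Δ v₂ + 𝕖 i v₂ * Δ v₁)
      ∎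
    where
    Δ : Fin n → ℚ
    Δ k = f i - f k

  module _ (f : Fin n → ℚ) {j} (j∈ : j ∈ V G₁)
           (f-Laplacian : ∀ i → Laplacian (A G) f i ≡ D G i - (W G + W G) * 𝕖 i j) where

    -- Only the bridge at `v₁` leaves `G₁`. Its term `f v₁ - f v₂` moves to the right and joins the
    -- extra degree 1 that `v₁` has in `G`; at indices outside `G₁` every term vanishes.
    restrict₁ : ∀ i → Laplacian (A G₁) f i ≡ D G₁ i + (1ℚ + (f v₂ - f v₁)) * 𝕖 i v₁ - (W G + W G) * 𝕖 i j
    restrict₁ i with i ∈? V G₁
    ... | yes i∈ = begin
      L₁                                        ≡⟨ solve 2 (λ l x → l := (l :+ con 0ℚ :+ x) :- x) refl L₁ (𝕖 i v₁ * (f v₁ - f v₂)) ⟩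
      (L₁ + 0ℚ + b) - b                         ≡⟨ cong (_- b) L ⟨
      Laplacian (A G) f i - b                   ≡⟨ cong (_- b) (f-Laplacian i) ⟩
      (D G i - w) - b                           ≡⟨ cong (λ z → (z - w) - b) (D-split i) ⟩
      (D G₁ i + D G₂ i + (𝕖 i v₁ + 𝕖 i v₂) - w) - b
                                                ≡⟨ cong₂ (λ y z → (D G₁ i + y + (𝕖 i v₁ + z) - w) - b) (D≡0 G₂ (disjoint i∈)) e₂≡0 ⟩
      (D G₁ i + 0ℚ + (𝕖 i v₁ + 0ℚ) - w) - b     ≡⟨ solve 5 (λ d e w x y → (d :+ con 0ℚ :+ (e :+ con 0ℚ) :- w) :- e :* (x :- y)
                                                     := d :+ (con 1ℚ :+ (y :- x)) :* e :- w) refl (D G₁ i) (𝕖 i v₁) w (f v₁) (f v₂) ⟩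
      D G₁ i + (1ℚ + (f v₂ - f v₁)) * 𝕖 i v₁ - w ∎
      where
      L₁ w b : ℚ
      L₁ = Laplacian (A G₁) f i
      w  = (W G + W G) * 𝕖 i j
      b  = 𝕖 i v₁ * (f v₁ - f v₂)
      e₂≡0 : 𝕖 i v₂ ≡ 0ℚ
      e₂≡0 = 𝕖-≢ λ { refl → v₂∉₁ i∈ }
      L : Laplacian (A G) f i ≡ L₁ + 0ℚ + b
      L = trans (Laplacian-split f i) (cong₂ (λ y z → L₁ + y + z) (Laplacian-outside G₂ f (disjoint i∈))
        (trans (cong₂ _+_ (𝕖*-cong i v₁ (λ k → f k - f v₂)) (trans (cong (_* (f i - f v₁)) e₂≡0) (ℚₚ.*-zeroˡ (f i - f v₁))))
          (ℚₚ.+-identityʳ b)))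
    ... | no i∉ = trans (Laplacian-outside G₁ f i∉) (sym (begin
      D G₁ i + c * 𝕖 i v₁ - (W G + W G) * 𝕖 i j   ≡⟨ cong (_- (W G + W G) * 𝕖 i j) (cong₂ (λ x y → x + c * y) (D≡0 G₁ i∉) (𝕖-≢ λ { refl → i∉ v₁∈ })) ⟩
      0ℚ + c * 0ℚ - (W G + W G) * 𝕖 i j           ≡⟨ cong (λ y → 0ℚ + c * 0ℚ - (W G + W G) * y) (𝕖-≢ λ { refl → i∉ j∈ }) ⟩
      0ℚ + c * 0ℚ - (W G + W G) * 0ℚ              ≡⟨ solve 2 (λ c w → con 0ℚ :+ c :* con 0ℚ :- w :* con 0ℚ := con 0ℚ) refl c (W G + W G) ⟩
      0ℚ                                          ∎))
      where
      c : ℚ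
      c = 1ℚ + (f v₂ - f v₁)

    -- Summing `restrict₁` over all indices gives `0 = 2 w₁ + (1 + δ) - 2 w`, where `w₁` and `w` are
    -- the edge counts of `G₁` and `G`; `W-split` then yields `δ`.
    crossing : f v₂ - f v₁ ≡ W G₂ + W G₂ + 1ℚ
    crossing = -‿cancel (begin
      δ - (W G₂ + W G₂ + 1ℚ)
        ≡⟨ solve 3 (λ d a b → d :- (b :+ b :+ con 1ℚ) := (a :+ a) :+ (con 1ℚ :+ d) :* con 1ℚ :- ((a :+ b :+ con 1ℚ) :+ (a :+ b :+ con 1ℚ)) :* con 1ℚ) refl δ (W G₁) (W G₂) ⟩
      (W G₁ + W G₁) + (1ℚ + δ) * 1ℚ - ((W G₁ + W G₂ + 1ℚ) + (W G₁ + W G₂ + 1ℚ)) * 1ℚ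
        ≡⟨ cong (λ w → (W G₁ + W G₁) + (1ℚ + δ) * 1ℚ - (w + w) * 1ℚ) W-split ⟨
      (W G₁ + W G₁) + (1ℚ + δ) * 1ℚ - (W G + W G) * 1ℚ
        ≡⟨ cong₂ _-_ (cong₂ _+_ (sym (handshake G₁)) (pull (1ℚ + δ) v₁)) (pull (W G + W G) j) ⟩
      ∑ (D G₁) + ∑ (λ i → (1ℚ + δ) * 𝕖 i v₁) - ∑ (λ i → (W G + W G) * 𝕖 i j)
        ≡⟨ cong (_- ∑ (λ i → (W G + W G) * 𝕖 i j)) (∑-distrib-+ (D G₁) (λ i → (1ℚ + δ) * 𝕖 i v₁)) ⟨
      ∑ (λ i → D G₁ i + (1ℚ + δ) * 𝕖 i v₁) - ∑ (λ i → (W G + W G) * 𝕖 i j)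
        ≡⟨ ∑-sub (λ i → D G₁ i + (1ℚ + δ) * 𝕖 i v₁) (λ i → (W G + W G) * 𝕖 i j) ⟨
      ∑ (λ i → D G₁ i + (1ℚ + δ) * 𝕖 i v₁ - (W G + W G) * 𝕖 i j)
        ≡⟨ sum-cong-≗ restrict₁ ⟨
      ∑ (Laplacian (A G₁) f)
        ≡⟨ ∑-Laplacian (A G₁) f (A-sym G₁) ⟩
      0ℚ
        ∎)
      where
      δ : ℚ
      δ = f v₂ - f v₁
      pull : ∀ c v → c * 1ℚ ≡ ∑ (λ i → c * 𝕖 i v)
      pull c v = trans (cong (c *_) (sym (∑-𝕖≡1 v))) (*-distribˡ-sum c (λ i → 𝕖 i v))

  module _ (conn : Connected G) (conn₁ : Connected G₁) where
    private
      M  = hit G conn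
      M₁ = hit G₁ conn₁
      w w₁ w₂ : ℚ
      w  = W G
      w₁ = W G₁
      w₂ = W G₂

    -- A walk from `v₂` to a target in `G₁` must pass through `v₁`. The added constant is the mean
    -- crossing time from `v₂` to `v₁`, the same for every such target.
    hit-crossing : ∀ {j} → j ∈ V G₁ → M v₂ j ≡ M v₁ j + (w₂ + w₂ + 1ℚ)
    hit-crossing {j} j∈ = begin
      M v₂ j                          ≡⟨ solve 2 (λ x y → x := y :+ (x :- y)) refl (M v₂ j) (M v₁ j) ⟩
      M v₁ j + (M v₂ j - M v₁ j)      ≡⟨ cong (_+_ (M v₁ j)) (crossing (λ k → M k j) j∈ (Laplacian-hit G conn (inside₁ j∈))) ⟩
      M v₁ j + (w₂ + w₂ + 1ℚ)         ∎

    Laplacian₁-hit : ∀ {j} → j ∈ V G₁ → ∀ i →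
                     Laplacian (A G₁) (λ k → M k j) i ≡ D G₁ i + (w₂ + w₂ + (1ℚ + 1ℚ)) * 𝕖 i v₁ - (w + w) * 𝕖 i j
    Laplacian₁-hit {j} j∈ i = trans (restrict₁ f j∈ fL i) (cong (λ c → D G₁ i + c * 𝕖 i v₁ - (w + w) * 𝕖 i j)
      (trans (cong (_+_ 1ℚ) (crossing f j∈ fL)) (solve 1 (λ b → con 1ℚ :+ (b :+ b :+ con 1ℚ) := b :+ b :+ (con 1ℚ :+ con 1ℚ)) refl w₂)))
      where
      f : Fin n → ℚ
      f k = M k j
      fL : ∀ i → Laplacian (A G) f i ≡ D G i - (W G + W G) * 𝕖 i j
      fL = Laplacian-hit G conn (inside₁ j∈)

    -- Until it reaches `v₁`, a walk started in `G₁` does not see the bridge. In the equations,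
    -- source and pole both sit at `v₁` and combine to the pole `- 2 w₁` of `G₁`, so the difference
    -- is harmonic.
    hit-to-v₁ : ∀ {i} → i ∈ V G₁ → M i v₁ ≡ M₁ i v₁
    hit-to-v₁ {i} i∈ = -‿cancel (begin
      M i v₁ - M₁ i v₁                       ≡⟨ as-combination i ⟨
      F i                                    ≡⟨ harmonic⇒constant G₁ conn₁ F harmonic i∈ v₁∈ ⟩
      F v₁                                   ≡⟨ as-combination v₁ ⟩
      M v₁ v₁ - M₁ v₁ v₁                     ≡⟨ cong₂ _-_ (hit-refl G conn v₁) (hit-refl G₁ conn₁ v₁) ⟩
      0ℚ - 0ℚ                                ≡⟨⟩
      0ℚ                                     ∎)
      where
      F : Fin n → ℚ
      F k = 1ℚ * M k v₁ + - 1ℚ * M₁ k v₁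
      as-combination : ∀ k → F k ≡ M k v₁ - M₁ k v₁
      as-combination k = solve 2 (λ x y → con 1ℚ :* x :+ (:- con 1ℚ) :* y := x :- y) refl (M k v₁) (M₁ k v₁)
      harmonic : ∀ i → Laplacian (A G₁) F i ≡ 0ℚ
      harmonic i = begin
        Laplacian (A G₁) F i
          ≡⟨ Laplacian-linear (A G₁) 1ℚ (- 1ℚ) (λ k → M k v₁) (λ k → M₁ k v₁) i ⟩
        1ℚ * Laplacian (A G₁) (λ k → M k v₁) i + - 1ℚ * Laplacian (A G₁) (λ k → M₁ k v₁) i
          ≡⟨ cong₂ (λ x y → 1ℚ * x + - 1ℚ * y) (Laplacian₁-hit v₁∈ i) (Laplacian-hit G₁ conn₁ v₁∈ i) ⟩
        1ℚ * (D G₁ i + (w₂ + w₂ + (1ℚ + 1ℚ)) * e - (w + w) * e) + - 1ℚ * (D G₁ i - (w₁ + w₁) * e)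
          ≡⟨ cong (λ w → 1ℚ * (D G₁ i + (w₂ + w₂ + (1ℚ + 1ℚ)) * e - (w + w) * e) + - 1ℚ * (D G₁ i - (w₁ + w₁) * e)) W-split ⟩
        1ℚ * (D G₁ i + (w₂ + w₂ + (1ℚ + 1ℚ)) * e - ((w₁ + w₂ + 1ℚ) + (w₁ + w₂ + 1ℚ)) * e) + - 1ℚ * (D G₁ i - (w₁ + w₁) * e)
          ≡⟨ solve 4 (λ d e a b → con 1ℚ :* (d :+ (b :+ b :+ (con 1ℚ :+ con 1ℚ)) :* e :- ((a :+ b :+ con 1ℚ) :+ (a :+ b :+ con 1ℚ)) :* e)
               :+ (:- con 1ℚ) :* (d :- (a :+ a) :* e) := con 0ℚ) refl (D G₁ i) e w₁ w₂ ⟩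
        0ℚ
          ∎
        where
        e : ℚ
        e = 𝕖 i v₁

    -- The weights in `F` are chosen so that its degree terms and its sources at `v₁` and `j` all
    -- cancel on `G₁`. Comparing `F v₁` with `F j`, where the diagonal values are 0, leaves this
    -- relation.
    hit-from-v₁ : ∀ {j} → j ∈ V G₁ → w₁ * M v₁ j ≡ w * M₁ v₁ j + (w₂ + 1ℚ) * M₁ j v₁
    hit-from-v₁ {j} j∈ = begin
      w₁ * M v₁ j
        ≡⟨ solve 2 (λ x c → x := x :+ c :* con 0ℚ) refl (w₁ * M v₁ j) (w₂ + 1ℚ) ⟩
      w₁ * M v₁ j + (w₂ + 1ℚ) * 0ℚ
        ≡⟨ cong (λ z → w₁ * M v₁ j + (w₂ + 1ℚ) * z) (hit-refl G conn v₁) ⟨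
      w₁ * M v₁ j + (w₂ + 1ℚ) * M v₁ v₁
        ≡⟨ solve 3 (λ x w y → x := (x :+ (:- w) :* y) :+ w :* y) refl (w₁ * M v₁ j + (w₂ + 1ℚ) * M v₁ v₁) w (M₁ v₁ j) ⟩
      F v₁ + w * M₁ v₁ j
        ≡⟨ cong (_+ w * M₁ v₁ j) (harmonic⇒constant G₁ conn₁ F harmonic v₁∈ j∈) ⟩
      (w₁ * M j j + (w₂ + 1ℚ) * M j v₁) + - w * M₁ j j + w * M₁ v₁ j
        ≡⟨ cong (λ z → (w₁ * z + (w₂ + 1ℚ) * M j v₁) + - w * M₁ j j + w * M₁ v₁ j) (hit-refl G conn j) ⟩
      (w₁ * 0ℚ + (w₂ + 1ℚ) * M j v₁) + - w * M₁ j j + w * M₁ v₁ j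
        ≡⟨ cong₂ (λ y z → (w₁ * 0ℚ + (w₂ + 1ℚ) * y) + - w * z + w * M₁ v₁ j) (hit-to-v₁ j∈) (hit-refl G₁ conn₁ j) ⟩
      (w₁ * 0ℚ + (w₂ + 1ℚ) * M₁ j v₁) + - w * 0ℚ + w * M₁ v₁ j
        ≡⟨ solve 4 (λ a x w y → (a :* con 0ℚ :+ x) :+ (:- w) :* con 0ℚ :+ w :* y := w :* y :+ x) refl
             w₁ ((w₂ + 1ℚ) * M₁ j v₁) w (M₁ v₁ j) ⟩
      w * M₁ v₁ j + (w₂ + 1ℚ) * M₁ j v₁
        ∎
      where
      E F : Fin n → ℚ
      E k = w₁ * M k j + (w₂ + 1ℚ) * M k v₁
      F k = E k + - w * M₁ k j
      harmonic : ∀ i → Laplacian (A G₁) F i ≡ 0ℚ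
      harmonic i = begin
        Laplacian (A G₁) F i
          ≡⟨ Laplacian-cong (A G₁) (λ k → cong (_+ - w * M₁ k j) (sym (ℚₚ.*-identityˡ (E k)))) i ⟩
        Laplacian (A G₁) (λ k → 1ℚ * E k + - w * M₁ k j) i
          ≡⟨ Laplacian-linear (A G₁) 1ℚ (- w) E (λ k → M₁ k j) i ⟩
        1ℚ * Laplacian (A G₁) E i + - w * Laplacian (A G₁) (λ k → M₁ k j) i
          ≡⟨ cong₂ (λ x y → 1ℚ * x + - w * y) (Laplacian-linear (A G₁) w₁ (w₂ + 1ℚ) (λ k → M k j) (λ k → M k v₁) i) (Laplacian-hit G₁ conn₁ j∈ i) ⟩
        1ℚ * (w₁ * Laplacian (A G₁) (λ k → M k j) i + (w₂ + 1ℚ) * Laplacian (A G₁) (λ k → M k v₁) i) + - w * (d - (w₁ + w₁) * eⱼ)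
          ≡⟨ cong₂ (λ x y → 1ℚ * (w₁ * x + (w₂ + 1ℚ) * y) + - w * (d - (w₁ + w₁) * eⱼ)) (Laplacian₁-hit j∈ i) (Laplacian₁-hit v₁∈ i) ⟩
        1ℚ * (w₁ * (d + (w₂ + w₂ + (1ℚ + 1ℚ)) * e - (w + w) * eⱼ) + (w₂ + 1ℚ) * (d + (w₂ + w₂ + (1ℚ + 1ℚ)) * e - (w + w) * e)) + - w * (d - (w₁ + w₁) * eⱼ)
          ≡⟨ cong (λ w → 1ℚ * (w₁ * (d + (w₂ + w₂ + (1ℚ + 1ℚ)) * e - (w + w) * eⱼ) + (w₂ + 1ℚ) * (d + (w₂ + w₂ + (1ℚ + 1ℚ)) * e - (w + w) * e)) + - w * (d - (w₁ + w₁) * eⱼ)) W-split ⟩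
        -- After `w` is expanded as `w₁ + w₂ + 1`, the coefficients of `d`, `e` and `eⱼ` vanish
        -- separately.
        _ ≡⟨ solve 5 (λ d e eⱼ a b →
               let c = b :+ b :+ (con 1ℚ :+ con 1ℚ)
                   w = a :+ b :+ con 1ℚ in
               con 1ℚ :* (a :* (d :+ c :* e :- (w :+ w) :* eⱼ) :+ (b :+ con 1ℚ) :* (d :+ c :* e :- (w :+ w) :* e)) :+ (:- w) :* (d :- (a :+ a) :* eⱼ)
               := con 0ℚ) refl d e eⱼ w₁ w₂ ⟩
        0ℚ
          ∎
        where
        d e eⱼ : ℚ
        d  = D G₁ i
        e  = 𝕖 i v₁
        eⱼ = 𝕖 i j

    -- Weighting `hit-from-v₁` by the degrees of `G₁` and summing produces `2 w₁ κ` and `2 w₁ α` on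
    -- the right; the common factor `w₁` is then cancelled.
    part₁ : ∀ {i₁} → i₁ ∈ V G₁ →
            ∑ (λ j → D G₁ j * M v₁ j) ≡ (w + w) * κ G₁ conn₁ i₁ + ((w₂ + 1ℚ) + (w₂ + 1ℚ)) * α G₁ conn₁ v₁
    part₁ {i₁} i₁∈ = by-edges (m G₁ ℕₚ.≟ 0)
      where
      k a S : ℚ
      k = κ G₁ conn₁ i₁
      a = α G₁ conn₁ v₁
      S = ∑ (λ j → D G₁ j * M v₁ j)
      term : ∀ j → w₁ * (D G₁ j * M v₁ j) ≡ w * (D G₁ j * M₁ v₁ j) + (w₂ + 1ℚ) * (D G₁ j * M₁ j v₁)
      term j with j ∈? V G₁
      ... | yes j∈ = begin
        w₁ * (D G₁ j * M v₁ j)                                            ≡⟨ solve 3 (λ w d x → w :* (d :* x) := d :* (w :* x)) refl w₁ (D G₁ j) (M v₁ j) ⟩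
        D G₁ j * (w₁ * M v₁ j)                                            ≡⟨ cong (D G₁ j *_) (hit-from-v₁ j∈) ⟩
        D G₁ j * (w * M₁ v₁ j + (w₂ + 1ℚ) * M₁ j v₁)                      ≡⟨ solve 5 (λ d w x c y → d :* (w :* x :+ c :* y) := w :* (d :* x) :+ c :* (d :* y)) refl
                                                                               (D G₁ j) w (M₁ v₁ j) (w₂ + 1ℚ) (M₁ j v₁) ⟩
        w * (D G₁ j * M₁ v₁ j) + (w₂ + 1ℚ) * (D G₁ j * M₁ j v₁)           ∎
      ... | no j∉ = begin
        w₁ * (D G₁ j * M v₁ j)                                            ≡⟨ cong (λ d → w₁ * (d * M v₁ j)) (D≡0 G₁ j∉) ⟩
        w₁ * (0ℚ * M v₁ j)                                                ≡⟨ solve 6 (λ u x w y c z → u :* (con 0ℚ :* x) := w :* (con 0ℚ :* y) :+ c :* (con 0ℚ :* z)) refl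
                                                                               w₁ (M v₁ j) w (M₁ v₁ j) (w₂ + 1ℚ) (M₁ j v₁) ⟩
        w * (0ℚ * M₁ v₁ j) + (w₂ + 1ℚ) * (0ℚ * M₁ j v₁)                   ≡⟨ cong (λ d → w * (d * M₁ v₁ j) + (w₂ + 1ℚ) * (d * M₁ j v₁)) (D≡0 G₁ j∉) ⟨
        w * (D G₁ j * M₁ v₁ j) + (w₂ + 1ℚ) * (D G₁ j * M₁ j v₁)           ∎
      scaled : w₁ * S ≡ w₁ * ((w + w) * k + ((w₂ + 1ℚ) + (w₂ + 1ℚ)) * a)
      scaled = begin
        w₁ * S                                                            ≡⟨ *-distribˡ-sum w₁ (λ j → D G₁ j * M v₁ j) ⟩
        ∑ (λ j → w₁ * (D G₁ j * M v₁ j))                                  ≡⟨ sum-cong-≗ term ⟩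
        ∑ (λ j → w * (D G₁ j * M₁ v₁ j) + (w₂ + 1ℚ) * (D G₁ j * M₁ j v₁)) ≡⟨ ∑-linear w (w₂ + 1ℚ) (λ j → D G₁ j * M₁ v₁ j) (λ j → D G₁ j * M₁ j v₁) ⟩
        w * kemeny G₁ conn₁ v₁ + (w₂ + 1ℚ) * ∑ (λ j → D G₁ j * M₁ j v₁)   ≡⟨ cong₂ (λ x y → w * x + (w₂ + 1ℚ) * y)
                                                                               (trans (kemeny-constant G₁ conn₁ v₁∈ i₁∈) (sym (2m*κ G₁ conn₁ i₁)))
                                                                               (sym (2m*α G₁ conn₁ v₁)) ⟩
        w * ((w₁ + w₁) * k) + (w₂ + 1ℚ) * ((w₁ + w₁) * a)                 ≡⟨ solve 5 (λ w u k c a → w :* ((u :+ u) :* k) :+ c :* ((u :+ u) :* a)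
                                                                                 := u :* ((w :+ w) :* k :+ (c :+ c) :* a)) refl w w₁ k (w₂ + 1ℚ) a ⟩
        w₁ * ((w + w) * k + ((w₂ + 1ℚ) + (w₂ + 1ℚ)) * a)                  ∎
      by-edges : Dec (m G₁ ≡ 0) → S ≡ (w + w) * k + ((w₂ + 1ℚ) + (w₂ + 1ℚ)) * a
      by-edges (no m≢0)  = *-cancelˡ w₁ (λ w₁≡0 → fromℕ≢0 m≢0 (trans (sym (W≡ G₁)) w₁≡0)) scaled
      -- If `G₁` is a single vertex, `w₁ = 0` cannot be cancelled, but the sum, `κ` and `α` are all
      -- 0.
      by-edges (yes eq) = begin
        S                                                  ≡⟨ ∑-zero (λ j → D G₁ j * M v₁ j) (λ j → trans (cong (_* M v₁ j) (edgeless⇒D≡0 G₁ eq j)) (ℚₚ.*-zeroˡ (M v₁ j))) ⟩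
        0ℚ                                                 ≡⟨ solve 2 (λ w c → con 0ℚ := w :* con 0ℚ :+ c :* con 0ℚ) refl (w + w) ((w₂ + 1ℚ) + (w₂ + 1ℚ)) ⟩
        (w + w) * 0ℚ + ((w₂ + 1ℚ) + (w₂ + 1ℚ)) * 0ℚ        ≡⟨ cong₂ (λ x y → (w + w) * x + ((w₂ + 1ℚ) + (w₂ + 1ℚ)) * y)
                                                                (edgeless⇒κ≡0 G₁ conn₁ eq i₁) (edgeless⇒α≡0 G₁ conn₁ eq v₁) ⟨
        (w + w) * k + ((w₂ + 1ℚ) + (w₂ + 1ℚ)) * a          ∎

-- Kemeny's constant of the whole graph, evaluated at `v₁`.

module _ {n} {G G₁ G₂ : Graph n} {v₁ v₂ : Fin n} (split : Split G G₁ G₂ v₁ v₂)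
         (conn : Connected G) (conn₁ : Connected G₁) (conn₂ : Connected G₂) where
  open Split split
  private
    M  = hit G conn
    w w₁ w₂ : ℚ
    w  = W G
    w₁ = W G₁
    w₂ = W G₂

  -- Targets weighted by their degree in `G₁` give `part₁`; those weighted by their degree in `G₂`
  -- give its mirror image plus the crossing time `c` per unit of degree, in all `c * 2 w₂`. The
  -- bridge adds one unit of degree at `v₁`, at distance 0, and one at `v₂`, at mean passage time
  -- `c`.
  2m*κ-split : ∀ {i i₁ i₂} → i ∈ V G → i₁ ∈ V G₁ → i₂ ∈ V G₂ →
    (w + w) * κ G conn i ≡
    ((w + w) * κ G₁ conn₁ i₁ + ((w₂ + 1ℚ) + (w₂ + 1ℚ)) * α G₁ conn₁ v₁)
    + ((w + w) * κ G₂ conn₂ i₂ + ((w₁ + 1ℚ) + (w₁ + 1ℚ)) * α G₂ conn₂ v₂)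
    + (w₁ + w₁ + 1ℚ) * (w₂ + w₂ + 1ℚ)
  2m*κ-split {i} {i₁} {i₂} i∈ i₁∈ i₂∈ = begin
    (w + w) * κ G conn i
      ≡⟨ trans (2m*κ G conn i) (kemeny-constant G conn i∈ (inside₁ v₁∈)) ⟩
    ∑ (λ j → D G j * M v₁ j)
      ≡⟨ sum-cong-≗ term ⟩
    ∑ (λ j → (D G₁ j * M v₁ j + D G₂ j * M v₂ j) + (c * D G₂ j + (𝕖 j v₁ * M v₁ j + 𝕖 j v₂ * M v₁ j)))
      ≡⟨ ∑-distrib-+ (λ j → D G₁ j * M v₁ j + D G₂ j * M v₂ j) (λ j → c * D G₂ j + (𝕖 j v₁ * M v₁ j + 𝕖 j v₂ * M v₁ j)) ⟩
    ∑ (λ j → D G₁ j * M v₁ j + D G₂ j * M v₂ j) + ∑ (λ j → c * D G₂ j + (𝕖 j v₁ * M v₁ j + 𝕖 j v₂ * M v₁ j))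
      ≡⟨ cong₂ _+_
           (trans (∑-distrib-+ (λ j → D G₁ j * M v₁ j) (λ j → D G₂ j * M v₂ j))
             (cong₂ _+_ (part₁ split conn conn₁ i₁∈) (part₁ (Split-sym split) conn conn₂ i₂∈)))
           (trans (∑-distrib-+ (λ j → c * D G₂ j) (λ j → 𝕖 j v₁ * M v₁ j + 𝕖 j v₂ * M v₁ j))
             (cong₂ _+_ (trans (∑-distrib-*ˡ c (D G₂)) (cong (c *_) (handshake G₂)))
               (trans (∑-distrib-+ (λ j → 𝕖 j v₁ * M v₁ j) (λ j → 𝕖 j v₂ * M v₁ j))
                 (cong₂ _+_ (trans (∑-𝕖 v₁ (M v₁)) (hit-refl G conn v₁)) (trans (∑-𝕖 v₂ (M v₁)) across))))) ⟩
    (P₁ + P₂) + (c * (w₂ + w₂) + (0ℚ + c))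
      ≡⟨ solve 3 (λ p c b → p :+ (c :* (b :+ b) :+ (con 0ℚ :+ c)) := p :+ c :* (b :+ b :+ con 1ℚ)) refl (P₁ + P₂) c w₂ ⟩
    P₁ + P₂ + c * (w₂ + w₂ + 1ℚ)
      ∎
    where
    c P₁ P₂ : ℚ
    c  = w₁ + w₁ + 1ℚ
    P₁ = (w + w) * κ G₁ conn₁ i₁ + ((w₂ + 1ℚ) + (w₂ + 1ℚ)) * α G₁ conn₁ v₁
    P₂ = (w + w) * κ G₂ conn₂ i₂ + ((w₁ + 1ℚ) + (w₁ + 1ℚ)) * α G₂ conn₂ v₂
    crossing₂ : ∀ {j} → j ∈ V G₂ → M v₁ j ≡ M v₂ j + c
    crossing₂ = hit-crossing (Split-sym split) conn conn₂
    across : M v₁ v₂ ≡ c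
    across = trans (crossing₂ v₂∈) (trans (cong (_+ c) (hit-refl G conn v₂)) (ℚₚ.+-identityˡ c))
    shift : ∀ j → D G₂ j * M v₁ j ≡ D G₂ j * M v₂ j + c * D G₂ j
    shift j with j ∈? V G₂
    ... | yes j∈ = trans (cong (D G₂ j *_) (crossing₂ j∈))
      (solve 3 (λ d x c → d :* (x :+ c) := d :* x :+ c :* d) refl (D G₂ j) (M v₂ j) c)
    ... | no j∉ = begin
      D G₂ j * M v₁ j                ≡⟨ cong (_* M v₁ j) (D≡0 G₂ j∉) ⟩
      0ℚ * M v₁ j                    ≡⟨ solve 3 (λ x y c → con 0ℚ :* x := con 0ℚ :* y :+ c :* con 0ℚ) refl (M v₁ j) (M v₂ j) c ⟩
      0ℚ * M v₂ j + c * 0ℚ           ≡⟨ cong (λ d → d * M v₂ j + c * d) (D≡0 G₂ j∉) ⟨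
      D G₂ j * M v₂ j + c * D G₂ j   ∎
    term : ∀ j → D G j * M v₁ j ≡ (D G₁ j * M v₁ j + D G₂ j * M v₂ j) + (c * D G₂ j + (𝕖 j v₁ * M v₁ j + 𝕖 j v₂ * M v₁ j))
    term j = begin
      D G j * M v₁ j
        ≡⟨ cong (_* M v₁ j) (D-split split j) ⟩
      (D G₁ j + D G₂ j + (𝕖 j v₁ + 𝕖 j v₂)) * M v₁ j
        ≡⟨ solve 5 (λ a b e e′ x → (a :+ b :+ (e :+ e′)) :* x := a :* x :+ b :* x :+ (e :* x :+ e′ :* x)) refl
             (D G₁ j) (D G₂ j) (𝕖 j v₁) (𝕖 j v₂) (M v₁ j) ⟩
      D G₁ j * M v₁ j + D G₂ j * M v₁ j + (𝕖 j v₁ * M v₁ j + 𝕖 j v₂ * M v₁ j)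
        ≡⟨ cong (λ z → D G₁ j * M v₁ j + z + (𝕖 j v₁ * M v₁ j + 𝕖 j v₂ * M v₁ j)) (shift j) ⟩
      D G₁ j * M v₁ j + (D G₂ j * M v₂ j + c * D G₂ j) + (𝕖 j v₁ * M v₁ j + 𝕖 j v₂ * M v₁ j)
        ≡⟨ solve 4 (λ a b c e → a :+ (b :+ c) :+ e := (a :+ b) :+ (c :+ e)) refl
             (D G₁ j * M v₁ j) (D G₂ j * M v₂ j) (c * D G₂ j) (𝕖 j v₁ * M v₁ j + 𝕖 j v₂ * M v₁ j) ⟩
      (D G₁ j * M v₁ j + D G₂ j * M v₂ j) + (c * D G₂ j + (𝕖 j v₁ * M v₁ j + 𝕖 j v₂ * M v₁ j))
        ∎

-- Division by twice the number of edges.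

edge⇒m≢0 : ∀ {n} (H : Graph n) {u v} → Graph._~_ H u v → m H ≢ 0
edge⇒m≢0 H u~v m≡0 = D≢0 H (Existence.Walk.adjacent⇒deg≢0 H u~v) (edgeless⇒D≡0 H m≡0 _)

theorem2p5 :
  ∀ {n} (G G₁ G₂ : Graph n) (v₁ v₂ : Fin n)
    (conn : Connected G) → IsBridge G v₁ v₂ →
    (comp₁ : IsComponent G₁ (G ∖⟨ v₁ , v₂ ⟩)) → v₁ ∈ V G₁ →
    (comp₂ : IsComponent G₂ (G ∖⟨ v₁ , v₂ ⟩)) → v₂ ∈ V G₂ →
    let conn₁ = component-connected comp₁
        conn₂ = component-connected comp₂ in
    ∀ (i i₁ i₂ : Fin n) → i ∈ V G → i₁ ∈ V G₁ → i₂ ∈ V G₂ →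
    κ G conn i ≡ κ G₁ conn₁ i₁ + κ G₂ conn₂ i₂
                 + ((m G₂ +ℕ 1) ÷ℕ m G) * α G₁ conn₁ v₁
                 + ((m G₁ +ℕ 1) ÷ℕ m G) * α G₂ conn₂ v₂
                 + ((2 *ℕ m G₁ +ℕ 1) *ℕ (2 *ℕ m G₂ +ℕ 1)) ÷ℕ (2 *ℕ m G)
theorem2p5 {n} G G₁ G₂ v₁ v₂ conn isBridge comp₁ v₁∈ comp₂ v₂∈ i i₁ i₂ i∈ i₁∈ i₂∈ =
  -- The bridge is itself an edge, so `m G` is nonzero and every quotient by `m G` or `2 * m G` can
  -- be cleared.
  *-cancelˡ (w + w) 2w≢0 (begin
    (w + w) * κ G conn i
      ≡⟨ 2m*κ-split (bridge-split G G₁ G₂ v₁ v₂ conn isBridge comp₁ v₁∈ comp₂ v₂∈) conn conn₁ conn₂ i∈ i₁∈ i₂∈ ⟩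
    ((w + w) * k₁ + ((W G₂ + 1ℚ) + (W G₂ + 1ℚ)) * a₁) + ((w + w) * k₂ + ((W G₁ + 1ℚ) + (W G₁ + 1ℚ)) * a₂)
      + (W G₁ + W G₁ + 1ℚ) * (W G₂ + W G₂ + 1ℚ)
      ≡⟨ cong₂ (λ x y → ((w + w) * k₁ + (x + x) * a₁) + ((w + w) * k₂ + (y + y) * a₂) + (W G₁ + W G₁ + 1ℚ) * (W G₂ + W G₂ + 1ℚ))
           (scaled G₂) (scaled G₁) ⟨
    ((w + w) * k₁ + (w * q₂ + w * q₂) * a₁) + ((w + w) * k₂ + (w * q₁ + w * q₁) * a₂)
      + (W G₁ + W G₁ + 1ℚ) * (W G₂ + W G₂ + 1ℚ)
      ≡⟨ cong (_+_ (((w + w) * k₁ + (w * q₂ + w * q₂) * a₁) + ((w + w) * k₂ + (w * q₁ + w * q₁) * a₂))) (sym scaled-product) ⟩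
    ((w + w) * k₁ + (w * q₂ + w * q₂) * a₁) + ((w + w) * k₂ + (w * q₁ + w * q₁) * a₂) + (w + w) * q
      ≡⟨ solve 8 (λ w k₁ k₂ q₁ q₂ a₁ a₂ q →
           ((w :+ w) :* k₁ :+ (w :* q₂ :+ w :* q₂) :* a₁) :+ ((w :+ w) :* k₂ :+ (w :* q₁ :+ w :* q₁) :* a₂) :+ (w :+ w) :* q
           := (w :+ w) :* (k₁ :+ k₂ :+ q₂ :* a₁ :+ q₁ :* a₂ :+ q)) refl w k₁ k₂ q₁ q₂ a₁ a₂ q ⟩
    (w + w) * (k₁ + k₂ + q₂ * a₁ + q₁ * a₂ + q)
      ∎)
  where
  conn₁ : Connected G₁
  conn₁ = component-connected comp₁
  conn₂ : Connected G₂
  conn₂ = component-connected comp₂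
  w k₁ k₂ a₁ a₂ q₁ q₂ q : ℚ
  w  = W G
  k₁ = κ G₁ conn₁ i₁
  k₂ = κ G₂ conn₂ i₂
  a₁ = α G₁ conn₁ v₁
  a₂ = α G₂ conn₂ v₂
  q₁ = (m G₁ +ℕ 1) ÷ℕ m G
  q₂ = (m G₂ +ℕ 1) ÷ℕ m G
  q  = ((2 *ℕ m G₁ +ℕ 1) *ℕ (2 *ℕ m G₂ +ℕ 1)) ÷ℕ (2 *ℕ m G)
  m≢0 : m G ≢ 0
  m≢0 = edge⇒m≢0 G (IsBridge.edge isBridge)
  2m≢0 : 2 *ℕ m G ≢ 0
  2m≢0 = m≢0 ∘ ℕₚ.m+n≡0⇒m≡0 (m G)
  2w : fromℕ (2 *ℕ m G) ≡ w + w
  2w = trans (fromℕ-2* (m G)) (cong₂ _+_ (sym (W≡ G)) (sym (W≡ G)))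
  2w≢0 : w + w ≢ 0ℚ
  2w≢0 eq = fromℕ≢0 2m≢0 (trans 2w eq)
  scaled : ∀ H → w * ((m H +ℕ 1) ÷ℕ m G) ≡ W H + 1ℚ
  scaled H = trans (cong (_* ((m H +ℕ 1) ÷ℕ m G)) (W≡ G))
    (trans (÷ℕ-cancel (m H +ℕ 1) m≢0) (trans (÷ℕ-+ (m H) 1 1) (cong (_+ 1ℚ) (sym (W≡ H)))))
  odd : ∀ (H : Graph n) → fromℕ (2 *ℕ m H +ℕ 1) ≡ W H + W H + 1ℚ
  odd H = trans (÷ℕ-+ (2 *ℕ m H) 1 1) (cong (_+ 1ℚ) (trans (fromℕ-2* (m H)) (cong₂ _+_ (sym (W≡ H)) (sym (W≡ H)))))
  scaled-product : (w + w) * q ≡ (W G₁ + W G₁ + 1ℚ) * (W G₂ + W G₂ + 1ℚ)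
  scaled-product = trans (cong (_* q) (sym 2w))
    (trans (÷ℕ-cancel ((2 *ℕ m G₁ +ℕ 1) *ℕ (2 *ℕ m G₂ +ℕ 1)) 2m≢0)
      (trans (fromℕ-* (2 *ℕ m G₁ +ℕ 1) (2 *ℕ m G₂ +ℕ 1)) (cong₂ _*_ (odd G₁) (odd G₂))))
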